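{- Consider discrete bidding play of the game $TTT$ (Tic-Tac-Toe in which Bob is declared the winner of any game that would normally be a tie), starting from the empty board, with total number of ordinary chips $k\ge 0$. (1) Moving in the center square is an optimal first move for Alice if and only if $k\neq 5$. (2) Moving in a corner square is an optimal first move for Alice if and only if $k\in\{0,1,2,3,4,5,6,7,9,11,12,13,14,19,20,22,26\}$.
   Context: $TTT$: on a $3\times 3$ board, initially empty, a move by Alice (Bob) places her (his) mark in an empty square. The first player to have three of their own marks in a row, column or diagonal wins; a full board with no such line counts as a win for Bob. The players do not alternate; bidding determines who makes each move. Discrete bidding: Alice and Bob hold nonnegative integer numbers of identical chips, $k$ in total, and exactly one of them holds the tie-breaking advantage $*$. Before each move both simultaneously bid a nonnegative integer not exceeding their own number of chips. The winner of the bid gives the amount of the winning bid to the other player and decides which player makes the next move. The higher bid wins; if the bids are tied, the holder of the tie-breaking advantage either declares the other player the winner of the bid and keeps the advantage, or declares himself the winner of the bid and gives the advantage to the other player. A player's chip count is an element of $\mathbb{N}\cup\mathbb{N}^*$: $a$ means $a$ chips without the tie-breaking advantage, $a^*$ means $a$ chips with it; the order is $0<0^*<1<1^*<2<\cdots$. For a fixed total $k$, let $f(TTT,k)$ be the threshold such that Alice has a winning strategy if and only if her initial chip count is at least $f(TTT,k)$ (with value $k+1$ if she never wins). For a given kind of first move (center, corner), consider the analogous threshold when Alice is required to make that move in case she makes the first move of the game (all other decisions of both players being unrestricted). The first move is called optimal for Alice, for total $k$, if this restricted threshold equals $f(TTT,k)$. -}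

module Defs where

open import Data.Fin using (Fin; #_)
import Data.Fin.Properties as Fin
open import Data.Fin.Subset using (Subset; ⁅_⁆; _∪_; _∈_; ⊤)
open import Data.Fin.Subset.Properties using (_∈?_)
open import Data.List using (List; []; _∷_)
open import Data.List.Relation.Unary.All using (All; all?)
open import Data.List.Relation.Unary.Any using (Any; any?)
open import Data.Maybe using (Maybe; just; nothing)
import Data.Maybe.Properties as Maybe
open import Data.Nat
open import Data.Nat.Properties
open import Data.Sum using (inj₁; inj₂)
open import Data.Product using (Σ; ∃; ∃-syntax; _×_; _,_; proj₁; proj₂)
open import Data.Vec using (Vec; []; _∷_; lookup; replicate; _[_]≔_)
import Data.Vec.Properties as Vec
open import Function using (_∘_; id)
open import Function.Bundles using (_⇔_; mk⇔)
open import Relation.Binary.Definitions using (DecidableEquality)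
open import Relation.Binary.PropositionalEquality
open import Relation.Nullary using (¬_; Dec; yes; no; contradiction)
open import Relation.Nullary.Decidable using (map′; _×-dec_; _→-dec_; ¬?)

data Player : Set where
  alice bob : Player

opponent : Player → Player
opponent alice = bob
opponent bob   = alice

-- Squares are numbered row by row, 0 1 2 / 3 4 5 / 6 7 8.
Square : Set
Square = Fin 9

Board : Set
Board = Vec (Maybe Player) 9

emptyBoard : Board
emptyBoard = replicate 9 nothing

lines : List (List Square)
lines = (# 0 ∷ # 1 ∷ # 2 ∷ []) ∷ (# 3 ∷ # 4 ∷ # 5 ∷ []) ∷ (# 6 ∷ # 7 ∷ # 8 ∷ [])
      ∷ (# 0 ∷ # 3 ∷ # 6 ∷ []) ∷ (# 1 ∷ # 4 ∷ # 7 ∷ []) ∷ (# 2 ∷ # 5 ∷ # 8 ∷ [])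
      ∷ (# 0 ∷ # 4 ∷ # 8 ∷ []) ∷ (# 2 ∷ # 4 ∷ # 6 ∷ []) ∷ []

HasLine : Player → Board → Set
HasLine p b = Any (All (λ s → lookup b s ≡ just p)) lines

Full : Board → Set
Full b = ∀ s → lookup b s ≢ nothing

center corner : Subset 9
center = ⁅ # 4 ⁆
corner = ⁅ # 0 ⁆ ∪ ⁅ # 2 ⁆ ∪ ⁅ # 6 ⁆ ∪ ⁅ # 8 ⁆

-- T is the set of squares in which Alice may make the first move of the
-- game; T = ⊤ is unrestricted play.
Legal : Subset 9 → Player → Board → Square → Set
Legal T alice b s = lookup b s ≡ nothing × (b ≡ emptyBoard → s ∈ T)
Legal T bob   b s = lookup b s ≡ nothing

record Chips : Set where
  constructor chips
  field
    ofAlice ofBob : ℕ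
    advantage     : Player

open Chips public

giveAdvantage : Player → Chips → Chips
giveAdvantage p (chips a b _) = chips a b p

pay : Player → ℕ → Chips → Chips
pay alice n (chips a b h) = chips (a ∸ n) (b + n) h
pay bob   n (chips a b h) = chips (a + n) (b ∸ n) h

-- Player p picks some x in X, and Alice needs P x.
Decide : Player → (X : Set) → (X → Set) → Set
Decide alice X P = Σ X P
Decide bob   X P = (x : X) → P x

-- W w c means that Alice can win after w has won the bid, leaving chips c.
-- In a tie, whether the holder h of the advantage declares w = h and gives
-- the advantage away, or declares w = opponent h and keeps it, the advantage
-- ends up with the opponent of w.
Outcome : (W : Player → Chips → Set) → Chips → ℕ → ℕ → Set
Outcome W c x y =
    (y < x → W alice (pay alice x c))
  × (x < y → W bob (pay bob y c))
  × (x ≡ y → Decide (advantage c) Player λ w →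
               W w (giveAdvantage (opponent w) (pay w x c)))

-- Bids are simultaneous: Alice's bid x may not depend on Bob's bid y, but
-- everything decided afterwards may depend on both.
Round : (W : Player → Chips → Set) → Chips → Set
Round W c = ∃[ x ] x ≤ ofAlice c × (∀ y → y ≤ ofBob c → Outcome W c x y)

-- An element of Wins T b c is a winning strategy for Alice from the board b
-- and chips c, as a tree branching over everything Bob can do.
data Wins (T : Subset 9) : Board → Chips → Set where
  won  : ∀ {b c} → HasLine alice b → Wins T b c
  play : ∀ {b c} → ¬ HasLine alice b → ¬ HasLine bob b → ¬ Full b →
         Round (λ w c′ → Decide w Player λ m →
                         Decide m (∃ (Legal T m b)) λ (s , _) →
                         Wins T (b [ s ]≔ just m) c′) c →
         Wins T b c

data ChipCount : Set where
  plain starred : ℕ → ChipCount   -- a and a*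

data _≤ᶜ_ : ChipCount → ChipCount → Set where
  plain≤plain     : ∀ {m n} → m ≤ n → plain m   ≤ᶜ plain n
  plain≤starred   : ∀ {m n} → m ≤ n → plain m   ≤ᶜ starred n
  starred≤plain   : ∀ {m n} → m < n → starred m ≤ᶜ plain n
  starred≤starred : ∀ {m n} → m ≤ n → starred m ≤ᶜ starred n

amount : ChipCount → ℕ
amount (plain a)   = a
amount (starred a) = a

start : ℕ → ChipCount → Chips
start k (plain a)   = chips a (k ∸ a) bob
start k (starred a) = chips a (k ∸ a) alice

-- The bound on t forces t = k + 1 when Alice never wins.
IsThreshold : Subset 9 → ℕ → ChipCount → Set
IsThreshold T k t =
    t ≤ᶜ plain (suc k)
  × (∀ c → amount c ≤ k → Wins T emptyBoard (start k c) ⇔ t ≤ᶜ c)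

-- Existence of the threshold: Wins is decidable, and it is preserved by
-- each step of 0 < 0* < 1 < 1* < ⋯ at a fixed total number of chips.

private

  data _↝_ : Chips → Chips → Set where
    grab  : ∀ {a b} → chips a b bob ↝ chips a b alice
    trade : ∀ {a b} → chips a (suc b) alice ↝ chips (suc a) b bob

  Up : (Chips → Set) → Set
  Up P = ∀ {c c′} → c ↝ c′ → P c → P c′

  trade-∸ : ∀ {P a b x} → Up P → x ≤ a →
            P (chips (a ∸ x) (suc b + x) alice) → P (chips (suc a ∸ x) (b + x) bob)
  trade-∸ {P} {a} {b} {x} up x≤a p =
    subst (λ n → P (chips n (b + x) bob)) (sym (+-∸-assoc 1 x≤a)) (up trade p)

  trade-+ : ∀ {P a b y} → Up P → y ≤ b →
            P (chips (a + y) (suc b ∸ y) alice) → P (chips (suc a + y) (b ∸ y) bob)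
  trade-+ {P} {a} {b} {y} up y≤b p =
    up trade (subst (λ n → P (chips (a + y) n alice)) (+-∸-assoc 1 y≤b) p)

  round-up : ∀ {W} → (∀ w → Up (W w)) → (∀ c → W bob c → W alice c) → Up (Round W)
  round-up {W} up weaken grab (x , x≤a , f) = x , x≤a , λ y y≤b →
    let (win , lose , tie) = f y y≤b in
    up alice grab ∘ win , up bob grab ∘ lose , λ x≡y → alice , tie x≡y alice
  round-up {W} up weaken (trade {a} {b}) (x , x≤a , f) with x ≤? b
  ... | no x≰b = x , m≤n⇒m≤1+n x≤a , λ y y≤b →
    let y<x = ≤-<-trans y≤b (≰⇒> x≰b) in
      (λ _ → trade-∸ {W alice} (up alice) x≤a (proj₁ (f y (m≤n⇒m≤1+n y≤b)) y<x))
    , (λ x<y → contradiction x<y (<-asym y<x))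
    , (λ x≡y → contradiction (sym x≡y) (<⇒≢ y<x))
  ... | yes x≤b with proj₂ (proj₂ (f x (m≤n⇒m≤1+n x≤b))) refl
  ... | alice , p = suc x , s≤s x≤a , λ y y≤b →
      (λ _ → q)
    , (λ 1+x<y → trade-+ {W bob} (up bob) y≤b
                   (proj₁ (proj₂ (f y (m≤n⇒m≤1+n y≤b))) (<-trans ≤-refl 1+x<y)))
    , (λ { refl → λ
         { alice → q
         ; bob   → up bob grab (trade-+ {W bob} (up bob) y≤b
                     (proj₁ (proj₂ (f y (m≤n⇒m≤1+n y≤b))) ≤-refl)) } })
    where
    q : W alice (chips (a ∸ x) (b + suc x) bob)
    q = subst (λ n → W alice (chips (a ∸ x) n bob)) (sym (+-suc b x)) p
  ... | bob , p = x , m≤n⇒m≤1+n x≤a , λ y y≤b →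
      (λ y<x → trade-∸ {W alice} (up alice) x≤a (proj₁ (f y (m≤n⇒m≤1+n y≤b)) y<x))
    , (λ x<y → trade-+ {W bob} (up bob) y≤b
                 (proj₁ (proj₂ (f y (m≤n⇒m≤1+n y≤b))) x<y))
    , (λ { refl → λ
         { alice → win x x≤a f p
         ; bob   → up bob grab (trade-+ {W bob} (up bob) y≤b p) } })
    where
    win : ∀ x → x ≤ a → (∀ y → y ≤ suc b → Outcome W (chips a (suc b) alice) x y) →
          W bob (chips (a + x) (suc b ∸ x) alice) →
          W alice (chips (suc a ∸ x) (b + x) bob)
    win zero    _   _ p = subst₂ (λ m n → W alice (chips (suc m) n bob))
                            (+-identityʳ a) (sym (+-identityʳ b))
                            (up alice trade (weaken _ p))
    win (suc x) x≤a f p =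
      trade-∸ {W alice} {x = suc x} (up alice) x≤a (proj₁ (f 0 z≤n) z<s)

  _≟ᴾ_ : DecidableEquality Player
  alice ≟ᴾ alice = yes refl
  alice ≟ᴾ bob   = no λ ()
  bob   ≟ᴾ alice = no λ ()
  bob   ≟ᴾ bob   = yes refl

  _≟ᶜ_ : DecidableEquality (Maybe Player)
  _≟ᶜ_ = Maybe.≡-dec _≟ᴾ_

  hasLine? : ∀ p b → Dec (HasLine p b)
  hasLine? p b = any? (all? λ s → lookup b s ≟ᶜ just p) lines

  full? : ∀ b → Dec (Full b)
  full? b = Fin.all? λ s → ¬? (lookup b s ≟ᶜ nothing)

  legal? : ∀ T p b s → Dec (Legal T p b s)
  legal? T alice b s =
    (lookup b s ≟ᶜ nothing) ×-dec (Vec.≡-dec _≟ᶜ_ b emptyBoard →-dec (s ∈? T))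
  legal? T bob   b s = lookup b s ≟ᶜ nothing

  legal⇒empty : ∀ {T} p {b s} → Legal T p b s → lookup b s ≡ nothing
  legal⇒empty alice = proj₁
  legal⇒empty bob   = id

  decidePlayer? : ∀ p {P : Player → Set} → (∀ x → Dec (P x)) → Dec (Decide p Player P)
  decidePlayer? alice P? with P? alice | P? bob
  ... | yes p | _     = yes (alice , p)
  ... | no _  | yes p = yes (bob , p)
  ... | no ¬p | no ¬q = no λ { (alice , p) → ¬p p ; (bob , q) → ¬q q }
  decidePlayer? bob P? with P? alice | P? bob
  ... | yes p | yes q = yes λ { alice → p ; bob → q }
  ... | no ¬p | _     = no λ f → ¬p (f alice)
  ... | yes _ | no ¬q = no λ f → ¬q (f bob)

  decideMove? : ∀ {L P : Square → Set} m → (∀ s → Dec (L s)) → (∀ s → L s → Dec (P s)) →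
                Dec (Decide m (∃ L) (P ∘ proj₁))
  decideMove? {L} {P} alice L? P? =
    map′ (λ (s , l , p) → (s , l) , p) (λ ((s , l) , p) → s , l , p) (Fin.any? both)
    where
    both : ∀ s → Dec (L s × P s)
    both s with L? s
    ... | no ¬l = no (¬l ∘ proj₁)
    ... | yes l = map′ (l ,_) proj₂ (P? s l)
  decideMove? {L} {P} bob L? P? =
    map′ (λ f (s , l) → f s l) (λ f s l → f (s , l)) (Fin.all? imp)
    where
    imp : ∀ s → Dec (L s → P s)
    imp s with L? s
    ... | no ¬l = yes λ l → contradiction l ¬l
    ... | yes l = map′ (λ p _ → p) (λ f → f l) (P? s l)

  round? : ∀ {W} → (∀ w c → Dec (W w c)) → ∀ c → Dec (Round W c)
  round? {W} W? c =
    map′ (λ { (x , s≤s x≤a , f) → x , x≤a , λ y y≤b → f (s≤s y≤b) })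
         (λ (x , x≤a , f) → x , s≤s x≤a , λ { {y} (s≤s y≤b) → f y y≤b })
         (anyUpTo? (λ x → allUpTo? (outcome? x) (suc (ofBob c))) (suc (ofAlice c)))
    where
    outcome? : ∀ x y → Dec (Outcome W c x y)
    outcome? x y = ((y <? x) →-dec W? _ _)
             ×-dec ((x <? y) →-dec W? _ _)
             ×-dec ((x ≟ y) →-dec decidePlayer? (advantage c) λ w → W? _ _)

  decide-map : ∀ p {X} {P Q : X → Set} → (∀ x → P x → Q x) → Decide p X P → Decide p X Q
  decide-map alice f (x , px) = x , f x px
  decide-map bob   f g x      = f x (g x)

  empties : ∀ {n} → Vec (Maybe Player) n → ℕ
  empties []            = 0
  empties (nothing ∷ v) = suc (empties v)
  empties (just _ ∷ v)  = empties v

  empties-< : ∀ {n} (v : Vec (Maybe Player) n) s p → lookup v s ≡ nothing →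
              empties (v [ s ]≔ just p) < empties v
  empties-< (nothing ∷ v) Fin.zero    p _  = ≤-refl
  empties-< (nothing ∷ v) (Fin.suc s) p eq = s≤s (empties-< v s p eq)
  empties-< (just _ ∷ v)  (Fin.suc s) p eq = empties-< v s p eq

  Good : Subset 9 → Board → Set
  Good T b = (∀ c → Dec (Wins T b c)) × Up (Wins T b)

  good : ∀ T n b → empties b < n → Good T b
  good T (suc n) b (s≤s le) = dec , up
    where
    ih : ∀ m s → Legal T m b s → Good T (b [ s ]≔ just m)
    ih m s l = good T n _ (<-≤-trans (empties-< b s m (legal⇒empty m l)) le)

    M : Player → Chips → Set
    M m c = Decide m (∃ (Legal T m b)) λ (s , _) → Wins T (b [ s ]≔ just m) c

    W : Player → Chips → Set
    W w c = Decide w Player λ m → M m c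

    W? : ∀ w c → Dec (W w c)
    W? w c = decidePlayer? w λ m →
             decideMove? m (legal? T m b) λ s l → proj₁ (ih m s l) c

    W-up : ∀ w → Up (W w)
    W-up w st = decide-map w λ m → decide-map m λ (s , l) → proj₂ (ih m s l) st

    dec : ∀ c → Dec (Wins T b c)
    dec c with hasLine? alice b
    ... | yes l = yes (won l)
    ... | no ¬l with hasLine? bob b
    ... | yes l′ = no λ { (won l) → ¬l l ; (play _ ¬l′ _ _) → ¬l′ l′ }
    ... | no ¬l′ with full? b
    ... | yes fl = no λ { (won l) → ¬l l ; (play _ _ ¬fl _) → ¬fl fl }
    ... | no ¬fl = map′ (play ¬l ¬l′ ¬fl)
                        (λ { (won l) → contradiction l ¬l ; (play _ _ _ r) → r })
                        (round? W? c)

    up : Up (Wins T b)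
    up st (won l)            = won l
    up st (play ¬l ¬l′ ¬f r) = play ¬l ¬l′ ¬f (round-up W-up (λ _ g → bob , g bob) st r)

  abstract
    good-start : ∀ T → Good T emptyBoard
    good-start T = good T 10 emptyBoard ≤-refl

  module _ (T : Subset 9) (k : ℕ) where

    P : ChipCount → Set
    P c = Wins T emptyBoard (start k c)

    P? : ∀ c → Dec (P c)
    P? c = proj₁ (good-start T) (start k c)

    step : Up (Wins T emptyBoard)
    step = proj₂ (good-start T)

    step-starred : ∀ {a} → P (plain a) → P (starred a)
    step-starred = step grab

    step-plain : ∀ {a} → suc a ≤ k → P (starred a) → P (plain (suc a))
    step-plain {a} a<k p =
      step trade (subst (λ n → Wins T emptyBoard (chips a n alice)) (+-∸-assoc 1 a<k) p)

    mono-plain : ∀ {m n} → m ≤′ n → n ≤ k → P (plain m) → P (plain n)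
    mono-plain ≤′-refl       n≤k p = p
    mono-plain (≤′-step m≤n) n≤k p =
      step-plain n≤k (step-starred (mono-plain m≤n (<⇒≤ n≤k) p))

    mono : ∀ {c d} → c ≤ᶜ d → amount d ≤ k → P c → P d
    mono (plain≤plain m≤n)     n≤k p = mono-plain (≤⇒≤′ m≤n) n≤k p
    mono (plain≤starred m≤n)   n≤k p = step-starred (mono-plain (≤⇒≤′ m≤n) n≤k p)
    mono (starred≤plain m<n)   n≤k p =
      mono-plain (≤⇒≤′ m<n) n≤k (step-plain (≤-trans m<n n≤k) p)
    mono (starred≤starred m≤n) n≤k p with m≤n⇒m<n∨m≡n m≤n
    ... | inj₂ refl = p
    ... | inj₁ m<n  = step-starred (mono (starred≤plain m<n) n≤k p)

    -- Search upwards from a, with d + a = k + 1, no count below a winning.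
    search : ∀ d a → d + a ≡ suc k →
             (∀ c → amount c ≤ k → P c → plain a ≤ᶜ c) → ∃ (IsThreshold T k)
    search zero    a refl low =
      plain a , plain≤plain ≤-refl , λ c c≤k → mk⇔ (low c c≤k) λ
        { (plain≤plain a≤c)   → contradiction c≤k (<⇒≱ a≤c)
        ; (plain≤starred a≤c) → contradiction c≤k (<⇒≱ a≤c) }
    search (suc d) a eq low with P? (plain a) | P? (starred a)
    ... | yes p | _ = plain a , plain≤plain a≤1+k , λ c c≤k →
            mk⇔ (low c c≤k) (λ le → mono le c≤k p)
      where a≤1+k = subst (a ≤_) eq (m≤n+m a (suc d))
    ... | no ¬p | yes p = starred a , starred≤plain a<1+k , λ c c≤k →
            mk⇔ (λ pc → raise c pc (low c c≤k pc)) (λ le → mono le c≤k p)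
      where
      a<1+k = subst (a <_) eq (s≤s (m≤n+m a d))
      raise : ∀ c → P c → plain a ≤ᶜ c → starred a ≤ᶜ c
      raise _ pc (plain≤starred le) = starred≤starred le
      raise _ pc (plain≤plain le) with m≤n⇒m<n∨m≡n le
      ... | inj₁ lt   = starred≤plain lt
      ... | inj₂ refl = contradiction pc ¬p
    ... | no ¬p | no ¬q =
            search d (suc a) (trans (+-suc d a) eq) λ c c≤k pc → raise c pc (low c c≤k pc)
      where
      raise : ∀ c → P c → plain a ≤ᶜ c → plain (suc a) ≤ᶜ c
      raise _ pc (plain≤plain le) with m≤n⇒m<n∨m≡n le
      ... | inj₁ lt   = plain≤plain lt
      ... | inj₂ refl = contradiction pc ¬p
      raise _ pc (plain≤starred le) with m≤n⇒m<n∨m≡n le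
      ... | inj₁ lt   = plain≤starred lt
      ... | inj₂ refl = contradiction pc ¬q

-- Abstract only so that type checking never unfolds the search; IsThreshold
-- determines the threshold uniquely.
abstract
  threshold-exists : ∀ T k → ∃ (IsThreshold T k)
  threshold-exists T k = search T k (suc k) 0 (+-identityʳ (suc k)) λ
    { (plain _) _ _ → plain≤plain z≤n ; (starred _) _ _ → plain≤starred z≤n }

threshold : Subset 9 → ℕ → ChipCount
threshold T k = proj₁ (threshold-exists T k)

threshold-correct : ∀ T k → IsThreshold T k (threshold T k)
threshold-correct T k = proj₂ (threshold-exists T k)

f : ℕ → ChipCount
f = threshold ⊤

Optimal : Subset 9 → ℕ → Set
Optimal T k = threshold T k ≡ f k

{-# OPTIONS --safe #-}
module Submission where

-- The value of a position with k chips in total is the number of Alice's threshold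
-- in the order 0 < 0* < 1 < 1* < ⋯. If x is the least value after a move of Alice and
-- y ≥ x the greatest after a move of Bob, the value is ⌈x/2⌉ + ⌊y/2⌋. At the empty
-- board the summand ⌊y/2⌋ is common to all restrictions T of the first move, so T is
-- optimal if and only if ⌈x/2⌉ is as small for T as for unrestricted play.
--
-- It remains to compare the values after Alice's move to the center, a corner or an
-- edge, for all k. A fixed strategy of one player bounds the values from one side, and
-- the strategies that are optimal for real-valued bids (the Richman game) turn out to
-- give bounds that decide every comparison. These bounds are evaluated one k at a time
-- for small k. For all k the rounding in each bid changes the value by at most 1/2, which
-- gives affine bounds with the Richman costs as slopes; these are 23/64 for the center,
-- 25/64 for a corner and 51/128 for an edge, so for large k the center is strictly best.

open import Defs
open import Data.Bool using (true; false; if_then_else_)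
open import Data.Fin using (Fin; zero; suc; #_; toℕ; fromℕ<)
import Data.Fin.Properties as Fin
open import Data.Fin.Subset using (Subset; ⊤) renaming (_∈_ to _∈ˢ_)
open import Data.Fin.Subset.Properties using (x∈⁅x⁆; x∈⁅y⁆⇒x≡y; ∈⊤)
open import Data.List using (List; []; _∷_; allFin; foldr; map)
open import Data.List.Extrema.Nat
  using (min; max; argmin; argmin-sel; f[argmin]≤f[xs]; min≤xs; xs≤max; max≤v⁺; v≤min⁺; min≤⊤)
open import Data.List.Membership.Propositional using (_∈_)
open import Data.List.Membership.Propositional.Properties using (∈-allFin; ∈-map⁺; ∈-map⁻)
import Data.List.Relation.Unary.All as All
open import Data.List.Relation.Unary.All using ([]; _∷_)
open import Data.List.Relation.Unary.Any using (here; there)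
open import Data.Maybe using (Maybe; just; nothing)
open import Data.Nat
open import Data.Nat.DivMod using (m/n≡1+[m∸n]/n)
open import Data.Nat.Properties
open import Data.Nat.Tactic.RingSolver using (solve-∀)
open import Data.Product using (∃; ∃-syntax; _×_; _,_; proj₁; proj₂)
open import Data.Sum using (_⊎_; inj₁; inj₂; [_,_])
open import Data.Vec
  using (Vec; []; _∷_; here; there; lookup; replicate; tabulate; zipWith; _[_]≔_)
open import Data.Vec.Properties
  using (lookup∘tabulate; lookup∘update; lookup-replicate; lookup-zipWith)
open import Function using (_∘_; id)
open import Function.Bundles using (_⇔_; mk⇔; Equivalence)
open import Relation.Binary.PropositionalEquality hiding ([_])
open import Relation.Nullary using (¬_; Dec; yes; no; does; contradiction)
open import Relation.Nullary.Decidable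
  using (map′; ¬?; _×-dec_; _⊎-dec_; _→-dec_; does-⇔; from-yes; toWitness)
open import Data.List.Membership.DecPropositional _≟_ using (_∈?_)

open Equivalence using (to; from)

-- Numbered chip counts and rounding of halves

-- Chip counts in their order, 0 < 0* < 1 < 1* < ⋯, are numbered from 0; with k
-- chips in total, lost k stands for a win that is out of reach.

rank : Player → ℕ → ℕ
rank bob   a = a + a
rank alice a = suc (a + a)

code : Chips → ℕ
code c = rank (advantage c) (ofAlice c)

total : Chips → ℕ
total c = ofAlice c + ofBob c

lost : ℕ → ℕ
lost k = suc k + suc k

-- The threshold of a position from the threshold x once Alice has won the bid and
-- the threshold y ≥ x once Bob has.
mid : ℕ → ℕ → ℕ
mid x y = ⌈ x /2⌉ + ⌊ y /2⌋

⌈/2⌉≤ : ∀ {x u} → x ≤ u + u → ⌈ x /2⌉ ≤ u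
⌈/2⌉≤ {u = u} le = ≤-trans (⌈n/2⌉-mono le) (≤-reflexive (sym (n≡⌈n+n/2⌉ u)))

⌈/2⌉≤suc : ∀ {x u} → x ≤ suc (u + u) → ⌈ x /2⌉ ≤ suc u
⌈/2⌉≤suc {u = u} le = ≤-trans (⌈n/2⌉-mono le) (s≤s (≤-reflexive (sym (n≡⌊n+n/2⌋ u))))

⌊/2⌋≤ : ∀ {y v} → y ≤ suc (v + v) → ⌊ y /2⌋ ≤ v
⌊/2⌋≤ {v = v} le = ≤-trans (⌊n/2⌋-mono le) (≤-reflexive (sym (n≡⌈n+n/2⌉ v)))

half-double-≤ : ∀ {m n} → m + m ≤ suc (n + n) → m ≤ n
half-double-≤ {m} {n} le = ≤-trans (≤-reflexive (n≡⌊n+n/2⌋ m)) (⌊/2⌋≤ le)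

≤⌈/2⌉+⌈/2⌉ : ∀ x → x ≤ ⌈ x /2⌉ + ⌈ x /2⌉
≤⌈/2⌉+⌈/2⌉ x = begin
  x                       ≡⟨ ⌊n/2⌋+⌈n/2⌉≡n x ⟨
  ⌊ x /2⌋ + ⌈ x /2⌉       ≤⟨ +-monoˡ-≤ _ (⌊n/2⌋≤⌈n/2⌉ x) ⟩
  ⌈ x /2⌉ + ⌈ x /2⌉       ∎
  where open ≤-Reasoning

≤1+⌊/2⌋+⌊/2⌋ : ∀ y → y ≤ suc (⌊ y /2⌋ + ⌊ y /2⌋)
≤1+⌊/2⌋+⌊/2⌋ zero          = z≤n
≤1+⌊/2⌋+⌊/2⌋ (suc zero)    = ≤-refl
≤1+⌊/2⌋+⌊/2⌋ (suc (suc y)) = s≤s (s≤s (≤-trans (≤1+⌊/2⌋+⌊/2⌋ y)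
  (≤-reflexive (sym (+-suc ⌊ y /2⌋ ⌊ y /2⌋)))))

-- Even thresholds are plain counts and odd ones are starred. When Alice holds the advantage, this
-- decides how she should resolve a tie.
⌈/2⌉-parity : ∀ x → x ≡ ⌈ x /2⌉ + ⌈ x /2⌉ ⊎ (∃[ u ] ⌈ x /2⌉ ≡ suc u × x ≡ suc (u + u))
⌈/2⌉-parity zero       = inj₁ refl
⌈/2⌉-parity (suc zero) = inj₂ (0 , refl , refl)
⌈/2⌉-parity (suc (suc x)) with ⌈/2⌉-parity x
... | inj₁ eq = inj₁ (cong suc (trans (cong suc eq) (sym (+-suc ⌈ x /2⌉ ⌈ x /2⌉))))
... | inj₂ (u , eq , x≡) = inj₂ (suc u , cong suc eq ,
        cong suc (trans (cong suc x≡) (cong suc (sym (+-suc u u)))))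

mid-mono : ∀ {x x′ y y′} → x ≤ x′ → y ≤ y′ → mid x y ≤ mid x′ y′
mid-mono x≤ y≤ = +-mono-≤ (⌈n/2⌉-mono x≤) (⌊n/2⌋-mono y≤)

x≤mid : ∀ {x y} → x ≤ y → x ≤ mid x y
x≤mid {x} {y} x≤y = begin
  x                    ≡⟨ ⌊n/2⌋+⌈n/2⌉≡n x ⟨
  ⌊ x /2⌋ + ⌈ x /2⌉    ≡⟨ +-comm ⌊ x /2⌋ _ ⟩
  ⌈ x /2⌉ + ⌊ x /2⌋    ≤⟨ +-monoʳ-≤ ⌈ x /2⌉ (⌊n/2⌋-mono x≤y) ⟩
  mid x y              ∎
  where open ≤-Reasoning

total-pay-alice : ∀ {a} n b → n ≤ a → (a ∸ n) + (b + n) ≡ a + b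
total-pay-alice {a} n b n≤a = begin
  (a ∸ n) + (b + n)  ≡⟨ cong ((a ∸ n) +_) (+-comm b n) ⟩
  (a ∸ n) + (n + b)  ≡⟨ +-assoc (a ∸ n) n b ⟨
  (a ∸ n) + n + b    ≡⟨ cong (_+ b) (m∸n+n≡m n≤a) ⟩
  a + b              ∎
  where open ≡-Reasoning

total-pay-bob : ∀ a {b} n → n ≤ b → (a + n) + (b ∸ n) ≡ a + b
total-pay-bob a {b} n n≤b = trans (+-assoc a n (b ∸ n)) (cong (a +_) (m+[n∸m]≡n n≤b))

+-cancelˡ-≤′ : ∀ u {v n m} → u + v ≤ n → n ≡ u + m → v ≤ m
+-cancelˡ-≤′ u le eq = +-cancelˡ-≤ u _ _ (≤-trans le (≤-reflexive eq))

-- The bidding round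

module _ {k x y : ℕ} {W : Player → Chips → Set} (x≤y : x ≤ y)
  (Wᴬ : ∀ c → total c ≡ k → W alice c ⇔ x ≤ code c)
  (Wᴮ : ∀ c → total c ≡ k → W bob c ⇔ y ≤ code c) where

  private
    u = ⌈ x /2⌉
    v = ⌊ y /2⌋

    winsᴬ : ∀ {a b h} → a + b ≡ k → x ≤ rank h a → W alice (chips a b h)
    winsᴬ eq = from (Wᴬ _ eq)

    winsᴮ : ∀ {a b h} → a + b ≡ k → y ≤ rank h a → W bob (chips a b h)
    winsᴮ eq = from (Wᴮ _ eq)

    y≤ : ∀ {n} → suc (v + v) ≤ n → y ≤ n
    y≤ = ≤-trans (≤1+⌊/2⌋+⌊/2⌋ y)

    +∸ : ∀ (P : ℕ → Set) w d → P w → P (w + d ∸ d)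
    +∸ P w d = subst P (sym (m+n∸n≡m w d))

  -- Alice bids all that she can spare and still win after winning the bid. If Bob bids more, his
  -- payment lifts her to `y`: the hypothesis on `mid x y` says just that.
  round⇐ : ∀ c → total c ≡ k → mid x y ≤ code c → Round W c
  round⇐ (chips a b bob) refl le with m≤n⇒∃[o]m+o≡n (⌈/2⌉≤ {u = a} (≤-trans (x≤mid x≤y) le))
  -- Bob resolves a tie, so both resolutions must be good for Alice: either she is left with `u`
  -- plain chips, or she receives `d` chips and the advantage.
  ... | d , refl = d , m≤n+m d u , λ y′ y′≤b →
      (λ _ → winsᴬ (total-pay-alice d b (m≤n+m d u))
               (+∸ (λ w → x ≤ w + w) u d (≤⌈/2⌉+⌈/2⌉ x)))
    , (λ d<y′ → winsᴮ (total-pay-bob (u + d) y′ y′≤b) (y≤ (begin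
         suc (v + v)                              ≤⟨ s≤s (+-mono-≤ v≤ v≤) ⟩
         suc (w + w)                              ≤⟨ n≤1+n _ ⟩
         suc (suc (w + w))                        ≡⟨ eq₂ u d ⟩
         (u + d + suc d) + (u + d + suc d)
           ≤⟨ +-mono-≤ (+-monoʳ-≤ (u + d) d<y′) (+-monoʳ-≤ (u + d) d<y′) ⟩
         (u + d + y′) + (u + d + y′)              ∎)))
    , λ { refl → λ
        { alice → winsᴬ (total-pay-alice d b (m≤n+m d u))
                    (+∸ (λ w → x ≤ w + w) u d (≤⌈/2⌉+⌈/2⌉ x))
        ; bob   → winsᴮ (total-pay-bob (u + d) d y′≤b) (y≤ (begin
            suc (v + v)                           ≤⟨ s≤s (+-mono-≤ v≤ v≤) ⟩
            suc (w + w)                           ≡⟨ cong suc (eq₃ u d) ⟩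
            suc ((u + d + d) + (u + d + d))       ∎)) } }
    where
    open ≤-Reasoning
    w = u + (d + d)
    eq₁ : ∀ u d → (u + d) + (u + d) ≡ u + (u + (d + d))
    eq₁ = solve-∀
    eq₂ : ∀ u d → suc (suc (u + (d + d) + (u + (d + d)))) ≡ (u + d + suc d) + (u + d + suc d)
    eq₂ = solve-∀
    eq₃ : ∀ u d → u + (d + d) + (u + (d + d)) ≡ (u + d + d) + (u + d + d)
    eq₃ = solve-∀
    v≤ : v ≤ w
    v≤ = +-cancelˡ-≤′ u le (eq₁ u d)
  round⇐ (chips a b alice) refl le with ⌈/2⌉-parity x
  ... | inj₁ x≡ with m≤n⇒∃[o]m+o≡n u≤a
    where
    u≤a : u ≤ a
    u≤a = ≮⇒≥ λ a<u → <⇒≱ (≤-<-trans (x≤mid x≤y) (s≤s le))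
      (≤-trans (≤-trans (≤-reflexive (cong suc (sym (+-suc a a)))) (+-mono-≤ a<u a<u))
        (≤-reflexive (sym x≡)))
  -- For even `x` the `u` chips are enough without the advantage, so on a tie Alice gives it away
  -- and declares herself the winner.
  ... | d , refl = d , m≤n+m d u , λ y′ y′≤b →
      (λ _ → winsᴬ (total-pay-alice d b (m≤n+m d u))
               (+∸ (λ w → x ≤ suc (w + w)) u d (m≤n⇒m≤1+n (≤⌈/2⌉+⌈/2⌉ x))))
    , (λ d<y′ → winsᴮ (total-pay-bob (u + d) y′ y′≤b) (y≤ (s≤s (begin
         v + v                                    ≤⟨ +-mono-≤ v≤ v≤ ⟩
         w + w                                    ≡⟨ eq₂ u d ⟩
         (u + d + suc d) + (u + d + suc d)
           ≤⟨ +-mono-≤ (+-monoʳ-≤ (u + d) d<y′) (+-monoʳ-≤ (u + d) d<y′) ⟩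
         (u + d + y′) + (u + d + y′)              ∎))))
    , λ { refl → alice , winsᴬ (total-pay-alice d b (m≤n+m d u))
                    (+∸ (λ w → x ≤ w + w) u d (≤⌈/2⌉+⌈/2⌉ x)) }
    where
    open ≤-Reasoning
    w = suc (u + (d + d))
    eq₁ : ∀ u d → suc ((u + d) + (u + d)) ≡ u + suc (u + (d + d))
    eq₁ = solve-∀
    eq₂ : ∀ u d → suc (u + (d + d)) + suc (u + (d + d)) ≡ (u + d + suc d) + (u + d + suc d)
    eq₂ = solve-∀
    v≤ : v ≤ w
    v≤ = +-cancelˡ-≤′ u le (eq₁ u d)
  round⇐ (chips a b alice) refl le | inj₂ (t , u≡ , x≡) with m≤n⇒∃[o]m+o≡n t≤a
    where
    t≤a : t ≤ a
    t≤a = s≤s⁻¹ (subst (_≤ suc a) u≡ (⌈/2⌉≤suc {u = a} (≤-trans (x≤mid x≤y) le)))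
  -- For odd `x` she needs only `t` chips with the advantage, so she can bid one more; on a tie she
  -- keeps the advantage and lets Bob pay.
  ... | d , refl = d , m≤n+m d t , λ y′ y′≤b →
      (λ _ → winsᴬ (total-pay-alice d b (m≤n+m d t))
               (+∸ (λ w → x ≤ suc (w + w)) t d (≤-reflexive x≡)))
    , (λ d<y′ → winsᴮ (total-pay-bob (t + d) y′ y′≤b) (y≤ (s≤s (up (<⇒≤ d<y′)))))
    , λ { refl → bob , winsᴮ (total-pay-bob (t + d) d y′≤b) (y≤ (s≤s (up ≤-refl))) }
    where
    open ≤-Reasoning
    eq₁ : ∀ t d → suc ((t + d) + (t + d)) ≡ suc t + (t + d + d)
    eq₁ = solve-∀
    v≤ : v ≤ t + d + d
    v≤ = +-cancelˡ-≤′ u le (trans (eq₁ t d) (cong (_+ (t + d + d)) (sym u≡)))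
    up : ∀ {y′} → d ≤ y′ → v + v ≤ (t + d + y′) + (t + d + y′)
    up d≤y′ = +-mono-≤ v≤′ v≤′
      where v≤′ = ≤-trans v≤ (+-monoʳ-≤ (t + d) d≤y′)

  -- Bob's replies `0`, `d` and `suc d` to the bid `d` suffice. They give `u + d ≤ m` and
  -- `v ≤ n + d` with `m + n` equal to the code, and the bid cancels in the sum. When Bob has too
  -- few chips for the reply that should bound `v`, the cap `y ≤ lost k` bounds it instead.
  round⇒ : y ≤ lost k → ∀ c → total c ≡ k → Round W c → mid x y ≤ code c
  round⇒ y≤l (chips a b h) refl (d , d≤a , resp) = go h resp
    where
    open ≤-Reasoning

    atᴬ : ∀ {a b h} → a + b ≡ k → W alice (chips a b h) → x ≤ rank h a
    atᴬ eq = to (Wᴬ _ eq)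

    atᴮ : ∀ {a b h} → a + b ≡ k → W bob (chips a b h) → y ≤ rank h a
    atᴮ eq = to (Wᴮ _ eq)

    u+d≤ : ∀ {m} → u ≤ m → m ≡ a ∸ d → u + d ≤ a
    u+d≤ u≤ refl = ≤-trans (+-monoˡ-≤ d u≤) (≤-reflexive (m∸n+n≡m d≤a))

    v≤k : v ≤ suc (a + b)
    v≤k = ⌊/2⌋≤ (m≤n⇒m≤1+n y≤l)

    sum : ∀ {m} n → u + d ≤ m → v ≤ n + d → u + v ≤ m + n
    sum {m} n u≤ v≤ = begin
      u + v        ≤⟨ +-monoʳ-≤ u v≤ ⟩
      u + (n + d)  ≡⟨ eq u n d ⟩
      (u + d) + n  ≤⟨ +-monoˡ-≤ n u≤ ⟩
      m + n        ∎
      where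
      eq : ∀ u n d → u + (n + d) ≡ (u + d) + n
      eq = solve-∀

    go : ∀ h → (∀ y′ → y′ ≤ b → Outcome W (chips a b h) d y′) → mid x y ≤ rank h a
    go bob resp with d ≤? b
    ... | yes d≤b = sum a
            (u+d≤ (⌈/2⌉≤ (atᴬ (total-pay-alice d b d≤a) (tie alice))) refl)
            (⌊/2⌋≤ (atᴮ (total-pay-bob a d d≤b) (tie bob)))
      where tie = proj₂ (proj₂ (resp d d≤b)) refl
    ... | no d≰b = sum a
            (u+d≤ (⌈/2⌉≤ (atᴬ (total-pay-alice d b d≤a)
                            (proj₁ (resp 0 z≤n) (m<n⇒0<n (≰⇒> d≰b))))) refl)
            (≤-trans v≤k (≤-trans (≤-reflexive (sym (+-suc a b))) (+-monoʳ-≤ a (≰⇒> d≰b))))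
    go alice resp with d ≤? b
    ... | no d≰b = sum a
            (≤-trans (+-monoˡ-≤ d (⌈/2⌉≤suc {u = a ∸ d} (atᴬ (total-pay-alice d b d≤a)
                            (proj₁ (resp 0 z≤n) (m<n⇒0<n (≰⇒> d≰b))))))
                     (s≤s (≤-reflexive (m∸n+n≡m d≤a))))
            (≤-trans v≤k (≤-trans (≤-reflexive (sym (+-suc a b))) (+-monoʳ-≤ a (≰⇒> d≰b))))
    ... | yes d≤b with proj₂ (proj₂ (resp d d≤b)) refl
    ... | alice , p = ≤-trans (sum (suc a)
            (u+d≤ (⌈/2⌉≤ (atᴬ (total-pay-alice d b d≤a) p)) refl) v≤)
            (≤-reflexive (+-suc a a))
      where
      v≤ : v ≤ suc a + d
      v≤ with d <? b
      ... | yes d<b = ≤-trans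
              (⌊/2⌋≤ (atᴮ (total-pay-bob a (suc d) d<b) (proj₁ (proj₂ (resp (suc d) d<b)) ≤-refl)))
              (≤-reflexive (+-suc a d))
      ... | no d≮b = ≤-trans v≤k (s≤s (+-monoʳ-≤ a (≮⇒≥ d≮b)))
    ... | bob , p = sum a u≤ v≤
      where
      v≤ : v ≤ a + d
      v≤ = ⌊/2⌋≤ (atᴮ (total-pay-bob a d d≤b) p)

      u≤ : u + d ≤ suc a
      u≤ with d ≟ 0
      ... | no d≢0 = ≤-trans (+-monoˡ-≤ d (⌈/2⌉≤suc {u = a ∸ d} (atᴬ (total-pay-alice d b d≤a)
                            (proj₁ (resp 0 z≤n) (n≢0⇒n>0 d≢0)))))
                     (s≤s (≤-reflexive (m∸n+n≡m d≤a)))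
      -- Bob cannot bid less than zero, so no reply makes Alice win outright. The tie still bounds
      -- `y`, and `x ≤ y` passes the bound on to `x`.
      ... | yes d≡0 = begin
        u + d    ≡⟨ cong (u +_) d≡0 ⟩
        u + 0    ≡⟨ +-identityʳ u ⟩
        u        ≤⟨ ⌈/2⌉≤suc {u = a} (subst (λ n → x ≤ suc (n + n))
                      (trans (cong (a +_) d≡0) (+-identityʳ a))
                      (≤-trans x≤y (atᴮ (total-pay-bob a d d≤b) p))) ⟩
        suc a    ∎

-- Values of positions

Cells : ℕ → Set
Cells = Vec (Maybe Player)

children : ∀ {n} → Player → Cells n → List (Cells n)
children p []            = []
children p (nothing ∷ b) = (just p ∷ b) ∷ map (nothing ∷_) (children p b)
children p (just q ∷ b)  = map (just q ∷_) (children p b)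

children⁺ : ∀ {n} p (b : Cells n) s → lookup b s ≡ nothing → (b [ s ]≔ just p) ∈ children p b
children⁺ p (nothing ∷ b) zero    _  = here refl
children⁺ p (nothing ∷ b) (suc s) eq = there (∈-map⁺ _ (children⁺ p b s eq))
children⁺ p (just q ∷ b)  (suc s) eq = ∈-map⁺ _ (children⁺ p b s eq)

children⁻ : ∀ {n} p (b : Cells n) {c} → c ∈ children p b →
            ∃[ s ] lookup b s ≡ nothing × c ≡ b [ s ]≔ just p
children⁻ p (nothing ∷ b) (here refl) = zero , refl , refl
children⁻ p (nothing ∷ b) (there c∈) with ∈-map⁻ _ c∈
... | _ , d∈ , refl = let (s , eq , d≡) = children⁻ p b d∈ in suc s , eq , cong (nothing ∷_) d≡
children⁻ p (just q ∷ b) c∈ with ∈-map⁻ _ c∈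
... | _ , d∈ , refl = let (s , eq , d≡) = children⁻ p b d∈ in suc s , eq , cong (just q ∷_) d≡

blanks : ∀ {n} → Cells n → ℕ
blanks []            = 0
blanks (nothing ∷ b) = suc (blanks b)
blanks (just _ ∷ b)  = blanks b

blanks-update : ∀ {n} (b : Cells n) s p → lookup b s ≡ nothing →
                blanks (b [ s ]≔ just p) < blanks b
blanks-update (nothing ∷ b) zero    p _  = ≤-refl
blanks-update (nothing ∷ b) (suc s) p eq = s≤s (blanks-update b s p eq)
blanks-update (just _ ∷ b)  (suc s) p eq = blanks-update b s p eq

update≢empty : ∀ (b : Board) s p → b [ s ]≔ just p ≢ emptyBoard
update≢empty b s p eq
  with trans (sym (lookup∘update s b (just p)))
             (trans (cong (λ b → lookup b s) eq) (lookup-replicate s nothing))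
... | ()

is? : ∀ p (x : Maybe Player) → Dec (x ≡ just p)
is? p     nothing      = no λ ()
is? alice (just alice) = yes refl
is? alice (just bob)   = no λ ()
is? bob   (just alice) = no λ ()
is? bob   (just bob)   = yes refl

-- Reading the squares off by pattern matching evaluates much faster than
-- deciding HasLine through lookup.
hasLine? : ∀ p b → Dec (HasLine p b)
hasLine? p (a ∷ b ∷ c ∷ d ∷ e ∷ f ∷ g ∷ h ∷ i ∷ []) = map′ to′ from′
  (line? a b c ⊎-dec line? d e f ⊎-dec line? g h i ⊎-dec line? a d g ⊎-dec
   line? b e h ⊎-dec line? c f i ⊎-dec line? a e i ⊎-dec line? c e g)
  where
  Line : (x y z : Maybe Player) → Set
  Line x y z = x ≡ just p × y ≡ just p × z ≡ just p

  line? : ∀ x y z → Dec (Line x y z)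
  line? x y z = is? p x ×-dec is? p y ×-dec is? p z

  to′ : _ → HasLine p (a ∷ b ∷ c ∷ d ∷ e ∷ f ∷ g ∷ h ∷ i ∷ [])
  to′ (inj₁ (x , y , z)) = here (x ∷ y ∷ z ∷ [])
  to′ (inj₂ (inj₁ (x , y , z))) = there (here (x ∷ y ∷ z ∷ []))
  to′ (inj₂ (inj₂ (inj₁ (x , y , z)))) = there (there (here (x ∷ y ∷ z ∷ [])))
  to′ (inj₂ (inj₂ (inj₂ (inj₁ (x , y , z))))) = there (there (there (here (x ∷ y ∷ z ∷ []))))
  to′ (inj₂ (inj₂ (inj₂ (inj₂ (inj₁ (x , y , z)))))) =
    there (there (there (there (here (x ∷ y ∷ z ∷ [])))))
  to′ (inj₂ (inj₂ (inj₂ (inj₂ (inj₂ (inj₁ (x , y , z))))))) =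
    there (there (there (there (there (here (x ∷ y ∷ z ∷ []))))))
  to′ (inj₂ (inj₂ (inj₂ (inj₂ (inj₂ (inj₂ (inj₁ (x , y , z)))))))) =
    there (there (there (there (there (there (here (x ∷ y ∷ z ∷ [])))))))
  to′ (inj₂ (inj₂ (inj₂ (inj₂ (inj₂ (inj₂ (inj₂ (x , y , z)))))))) =
    there (there (there (there (there (there (there (here (x ∷ y ∷ z ∷ []))))))))

  from′ : HasLine p (a ∷ b ∷ c ∷ d ∷ e ∷ f ∷ g ∷ h ∷ i ∷ []) → _
  from′ (here (x ∷ y ∷ z ∷ [])) = inj₁ (x , y , z)
  from′ (there (here (x ∷ y ∷ z ∷ []))) = inj₂ (inj₁ (x , y , z))
  from′ (there (there (here (x ∷ y ∷ z ∷ [])))) = inj₂ (inj₂ (inj₁ (x , y , z)))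
  from′ (there (there (there (here (x ∷ y ∷ z ∷ []))))) =
    inj₂ (inj₂ (inj₂ (inj₁ (x , y , z))))
  from′ (there (there (there (there (here (x ∷ y ∷ z ∷ [])))))) =
    inj₂ (inj₂ (inj₂ (inj₂ (inj₁ (x , y , z)))))
  from′ (there (there (there (there (there (here (x ∷ y ∷ z ∷ []))))))) =
    inj₂ (inj₂ (inj₂ (inj₂ (inj₂ (inj₁ (x , y , z))))))
  from′ (there (there (there (there (there (there (here (x ∷ y ∷ z ∷ [])))))))) =
    inj₂ (inj₂ (inj₂ (inj₂ (inj₂ (inj₂ (inj₁ (x , y , z)))))))
  from′ (there (there (there (there (there (there (there (here (x ∷ y ∷ z ∷ []))))))))) =
    inj₂ (inj₂ (inj₂ (inj₂ (inj₂ (inj₂ (inj₂ (x , y , z)))))))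

full? : ∀ {n} (b : Cells n) → Dec (∀ s → lookup b s ≢ nothing)
full? []            = yes λ ()
full? (nothing ∷ b) = no λ fl → fl zero refl
full? (just _ ∷ b)  = map′ (λ { fl zero () ; fl (suc s) → fl s }) (_∘ suc) (full? b)

-- Alice's lines are tested first because `won` applies even on boards where Bob has a line too.
winner : Board → Maybe Player
winner b = if does (hasLine? alice b) then just alice
           else if does (hasLine? bob b ⊎-dec full? b) then just bob else nothing

data Winner (b : Board) : Maybe Player → Set where
  aliceWins : HasLine alice b → Winner b (just alice)
  bobWins   : ¬ HasLine alice b → HasLine bob b ⊎ Full b → Winner b (just bob)
  noneYet   : ¬ HasLine alice b → ¬ HasLine bob b → ¬ Full b → Winner b nothing

winner-spec : ∀ b → Winner b (winner b)
winner-spec b with hasLine? alice b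
... | yes l = aliceWins l
... | no ¬l with hasLine? bob b | full? b
... | yes l′ | _      = bobWins ¬l (inj₁ l′)
... | no _   | yes fl = bobWins ¬l (inj₂ fl)
... | no ¬l′ | no ¬fl = noneYet ¬l ¬l′ ¬fl

outcome : Maybe Player → ℕ → ℕ → ℕ
outcome (just alice) l v = 0
outcome (just bob)   l v = l
outcome nothing      l v = v

-- Abstract because unfolded minima of stuck terms grow exponentially in type checking.
abstract
  bestMove : ∀ {A : Set} → ℕ → (A → ℕ) → List A → ℕ
  bestMove k v bs = min (lost k) (map v bs)

  worstMove : ∀ {A : Set} → (A → ℕ) → List A → ℕ
  worstMove v bs = max 0 (map v bs)

  worstMove≤ : ∀ {A : Set} {n} {v : A → ℕ} bs → (∀ {b} → b ∈ bs → v b ≤ n) → worstMove v bs ≤ n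
  worstMove≤ bs h = max≤v⁺ z≤n (All.tabulate λ w∈ → let (_ , b∈ , w≡) = ∈-map⁻ _ w∈ in
    subst (_≤ _) (sym w≡) (h b∈))

  ≤worstMove : ∀ {A : Set} {v : A → ℕ} {b} bs → b ∈ bs → v b ≤ worstMove v bs
  ≤worstMove {v = v} bs b∈ = All.lookup (xs≤max 0 (map v bs)) (∈-map⁺ v b∈)

  ≤bestMove : ∀ {A : Set} {k n} {v : A → ℕ} bs → n ≤ lost k → (∀ {b} → b ∈ bs → n ≤ v b) →
              n ≤ bestMove k v bs
  ≤bestMove bs n≤ h = v≤min⁺ n≤ (All.tabulate λ w∈ → let (_ , b∈ , w≡) = ∈-map⁻ _ w∈ in
    subst (_ ≤_) (sym w≡) (h b∈))

  bestMove≤ : ∀ {A : Set} {k} {v : A → ℕ} {b} bs → b ∈ bs → bestMove k v bs ≤ v b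
  bestMove≤ {k = k} {v} bs b∈ = All.lookup (min≤xs (lost k) (map v bs)) (∈-map⁺ v b∈)

  bestMove≤lost : ∀ {A : Set} {k} {v : A → ℕ} bs → bestMove k v bs ≤ lost k
  bestMove≤lost {k = k} {v} bs = min≤⊤ (lost k) (map v bs)

  bestMove-sel : ∀ {A : Set} {k} {v : A → ℕ} bs → bestMove k v bs < lost k →
                 ∃[ b ] b ∈ bs × bestMove k v bs ≡ v b
  bestMove-sel {k = k} {v} bs lt with argmin-sel id (lost k) (map v bs)
  ... | inj₁ eq = contradiction eq (<⇒≢ lt)
  ... | inj₂ m∈ = ∈-map⁻ v m∈

-- The winner of a bid decides who moves, so Alice takes the smaller and Bob the larger of `x` and
-- `y`, without any claim that moving is an asset. The second argument is fuel; it has to exceed the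
-- number of blanks.
value : ℕ → ℕ → Board → ℕ
value k zero    b = lost k
value k (suc n) b = outcome (winner b) (lost k) (mid (x ⊓ y) (x ⊔ y))
  where
  x = bestMove k (value k n) (children alice b)
  y = worstMove (value k n) (children bob b)

mid≤lost : ∀ {k x y} → x ≤ lost k → y ≤ lost k → mid x y ≤ lost k
mid≤lost {k} {x} {y} x≤ y≤ = +-mono-≤ (⌈/2⌉≤ {u = suc k} x≤) (⌊/2⌋≤ {v = suc k} (m≤n⇒m≤1+n y≤))

value≤lost : ∀ k n b → value k n b ≤ lost k
value≤lost k zero    b = ≤-refl
value≤lost k (suc n) b with winner b
... | just alice = z≤n
... | just bob   = ≤-refl
... | nothing    = mid≤lost {k} (m≤n⇒m⊓o≤n _ x≤) (⊔-lub x≤ y≤)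
  where
  x≤ = bestMove≤lost {k = k} {value k n} (children alice b)
  y≤ = worstMove≤ (children bob b) (λ {c} _ → value≤lost k n c)

code<lost : ∀ {k} c → total c ≡ k → code c < lost k
code<lost (chips a b alice) refl = s≤s (≤-trans (≤-reflexive (sym (+-suc a a)))
  (+-mono-≤ (m≤m+n a b) (s≤s (m≤m+n a b))))
code<lost (chips a b bob)   refl = s≤s (+-mono-≤ (m≤m+n a b) (m≤n⇒m≤1+n (m≤m+n a b)))

Move : Subset 9 → Board → Player → Chips → Set
Move T b m c = Decide m (∃ (Legal T m b)) λ (s , _) → Wins T (b [ s ]≔ just m) c

-- The thresholds of the two moves are left arbitrary, so that this serves ongoing positions as well
-- as the empty board under each restriction `T`.
wins-step : ∀ {T b k x y} → winner b ≡ nothing → x ≤ lost k → y ≤ lost k →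
            (∀ c → total c ≡ k → Move T b alice c ⇔ x ≤ code c) →
            (∀ c → total c ≡ k → Move T b bob c ⇔ y ≤ code c) →
            ∀ c → total c ≡ k → Wins T b c ⇔ mid (x ⊓ y) (x ⊔ y) ≤ code c
wins-step {T} {b} {k} {x} {y} none x≤ y≤ A B c eq with winner b | winner-spec b
wins-step {T} {b} {k} {x} {y} refl x≤ y≤ A B c eq | .nothing | noneYet ¬l ¬l′ ¬fl =
  mk⇔ (λ { (won l) → contradiction l ¬l
         ; (play _ _ _ r) → round⇒ {W = W} x⊓y≤x⊔y Wᴬ Wᴮ (⊔-lub x≤ y≤) c eq r })
      (λ le → play ¬l ¬l′ ¬fl (round⇐ {W = W} x⊓y≤x⊔y Wᴬ Wᴮ c eq le))
  where
  W : Player → Chips → Set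
  W w c = Decide w Player λ m → Move T b m c

  x⊓y≤x⊔y = ≤-trans (m⊓n≤m x y) (m≤m⊔n x y)

  Wᴬ : ∀ c → total c ≡ k → W alice c ⇔ x ⊓ y ≤ code c
  Wᴬ c eq = mk⇔ (λ { (alice , p) → m≤n⇒m⊓o≤n y (to (A c eq) p)
                   ; (bob , p)   → m≤n⇒o⊓m≤n x (to (B c eq) p) }) wins
    where
    wins : x ⊓ y ≤ code c → W alice c
    wins le with ⊓-sel x y
    ... | inj₁ ≡x = alice , from (A c eq) (subst (_≤ code c) ≡x le)
    ... | inj₂ ≡y = bob , from (B c eq) (subst (_≤ code c) ≡y le)

  Wᴮ : ∀ c → total c ≡ k → W bob c ⇔ x ⊔ y ≤ code c
  Wᴮ c eq = mk⇔ (λ p → ⊔-lub (to (A c eq) (p alice)) (to (B c eq) (p bob)))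
                (λ { le alice → from (A c eq) (m⊔n≤o⇒m≤o x y le)
                   ; le bob   → from (B c eq) (m⊔n≤o⇒n≤o x y le) })

Exact : Subset 9 → ℕ → Board → ℕ → Set
Exact T k b v = ∀ c → total c ≡ k → Wins T b c ⇔ v ≤ code c

bob-moves : ∀ {T k b} {v : Board → ℕ} →
            (∀ s → lookup b s ≡ nothing → Exact T k (b [ s ]≔ just bob) (v (b [ s ]≔ just bob))) →
            ∀ c → total c ≡ k → Move T b bob c ⇔ worstMove v (children bob b) ≤ code c
bob-moves {k = k} {b} {v} exact c eq = mk⇔
  (λ p → worstMove≤ (children bob b) λ c∈ → let (s , s-empty , c≡) = children⁻ bob b c∈ in
    subst (λ b → v b ≤ code c) (sym c≡) (to (exact s s-empty c eq) (p (s , s-empty))))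
  (λ le (s , s-empty) → from (exact s s-empty c eq)
    (≤-trans (≤worstMove (children bob b) (children⁺ bob b s s-empty)) le))

-- `T` restricts Alice at the empty board only, and no move leads back there, so one value is right
-- for every `T`.
value-exact : ∀ n {T k b} → blanks b < n → b ≢ emptyBoard → Exact T k b (value k n b)
value-exact (suc n) {T} {k} {b} b<n b≢ c eq with winner b in none | winner-spec b
... | _ | aliceWins l = mk⇔ (λ _ → z≤n) (λ _ → won l)
... | _ | bobWins ¬l l′ = mk⇔
        (λ { (won l) → contradiction l ¬l
           ; (play _ ¬l′ ¬fl _) → contradiction l′ [ ¬l′ , ¬fl ] })
        (λ le → contradiction (code<lost c eq) (≤⇒≯ le))
... | _ | noneYet _ _ _ = wins-step none (bestMove≤lost (children alice b))
        (worstMove≤ (children bob b) (λ {c} _ → value≤lost k n c)) alice-moves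
        (bob-moves (exact bob)) c eq
  where
  exact : ∀ p s → lookup b s ≡ nothing →
          Exact T k (b [ s ]≔ just p) (value k n (b [ s ]≔ just p))
  exact p s s-empty = value-exact n (<-≤-trans (blanks-update b s p s-empty) (s≤s⁻¹ b<n))
                        (update≢empty b s p)

  alice-moves : ∀ c → total c ≡ k →
                Move T b alice c ⇔ bestMove k (value k n) (children alice b) ≤ code c
  alice-moves c eq = mk⇔
    (λ ((s , s-empty , _) , p) →
      ≤-trans (bestMove≤ (children alice b) (children⁺ alice b s s-empty))
              (to (exact alice s s-empty c eq) p))
    -- A code below `lost k` excludes the default of the minimum, so an actual move attains it.
    λ le → let (_ , c∈ , ≡v) = bestMove-sel (children alice b) (≤-<-trans le (code<lost c eq))
               (s , s-empty , c≡) = children⁻ alice b c∈ in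
      (s , s-empty , λ b≡ → contradiction b≡ b≢) ,
      from (exact alice s s-empty c eq)
        (≤-trans (≤-reflexive (sym (trans ≡v (cong (value k n) c≡)))) le)

-- Rotation by a quarter turn

rotate : Board → Board
rotate (a ∷ b ∷ c ∷ d ∷ e ∷ f ∷ g ∷ h ∷ i ∷ []) = g ∷ d ∷ a ∷ h ∷ e ∷ b ∷ i ∷ f ∷ c ∷ []

rotate⁴ : ∀ b → rotate (rotate (rotate (rotate b))) ≡ b
rotate⁴ (a ∷ b ∷ c ∷ d ∷ e ∷ f ∷ g ∷ h ∷ i ∷ []) = refl

rotate-update : ∀ b s p → lookup b s ≡ nothing →
  ∃[ t ] lookup (rotate b) t ≡ nothing × rotate (b [ s ]≔ just p) ≡ rotate b [ t ]≔ just p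
rotate-update (a ∷ b ∷ c ∷ d ∷ e ∷ f ∷ g ∷ h ∷ i ∷ []) s p eq with s
... | zero = # 2 , eq , refl
... | suc zero = # 5 , eq , refl
... | suc (suc zero) = # 8 , eq , refl
... | suc (suc (suc zero)) = # 1 , eq , refl
... | suc (suc (suc (suc zero))) = # 4 , eq , refl
... | suc (suc (suc (suc (suc zero)))) = # 7 , eq , refl
... | suc (suc (suc (suc (suc (suc zero))))) = # 0 , eq , refl
... | suc (suc (suc (suc (suc (suc (suc zero)))))) = # 3 , eq , refl
... | suc (suc (suc (suc (suc (suc (suc (suc zero))))))) = # 6 , eq , refl

rotate-line : ∀ {p} b → HasLine p b → HasLine p (rotate b)
rotate-line (a ∷ b ∷ c ∷ d ∷ e ∷ f ∷ g ∷ h ∷ i ∷ []) l with l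
... | here (x ∷ y ∷ z ∷ []) = there (there (there (there (there (here (x ∷ y ∷ z ∷ []))))))
... | there (here (x ∷ y ∷ z ∷ [])) = there (there (there (there (here (x ∷ y ∷ z ∷ [])))))
... | there (there (here (x ∷ y ∷ z ∷ []))) = there (there (there (here (x ∷ y ∷ z ∷ []))))
... | there (there (there (here (x ∷ y ∷ z ∷ [])))) = here (z ∷ y ∷ x ∷ [])
... | there (there (there (there (here (x ∷ y ∷ z ∷ []))))) = there (here (z ∷ y ∷ x ∷ []))
... | there (there (there (there (there (here (x ∷ y ∷ z ∷ [])))))) =
        there (there (here (z ∷ y ∷ x ∷ [])))
... | there (there (there (there (there (there (here (x ∷ y ∷ z ∷ []))))))) =
        there (there (there (there (there (there (there (here (x ∷ y ∷ z ∷ []))))))))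
... | there (there (there (there (there (there (there (here (x ∷ y ∷ z ∷ [])))))))) =
        there (there (there (there (there (there (here (z ∷ y ∷ x ∷ [])))))))

rotate-full : ∀ b → Full b → Full (rotate b)
rotate-full (a ∷ b ∷ c ∷ d ∷ e ∷ f ∷ g ∷ h ∷ i ∷ []) fl s with s
... | zero = fl (# 6)
... | suc zero = fl (# 3)
... | suc (suc zero) = fl (# 0)
... | suc (suc (suc zero)) = fl (# 7)
... | suc (suc (suc (suc zero))) = fl (# 4)
... | suc (suc (suc (suc (suc zero)))) = fl (# 1)
... | suc (suc (suc (suc (suc (suc zero))))) = fl (# 8)
... | suc (suc (suc (suc (suc (suc (suc zero)))))) = fl (# 5)
... | suc (suc (suc (suc (suc (suc (suc (suc zero))))))) = fl (# 2)

-- Three further quarter turns lead back to `b`, so invariance in one direction gives both.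
rotate-invariant : (P : Board → Set) → (∀ b → P b → P (rotate b)) → ∀ b → P (rotate b) ⇔ P b
rotate-invariant P h b = mk⇔ (subst P (rotate⁴ b) ∘ h _ ∘ h _ ∘ h _) (h b)

winner-rotate : ∀ b → winner (rotate b) ≡ winner b
winner-rotate b = cong₂ (λ x y → if x then just alice else if y then just bob else nothing)
  (does-⇔ (rotate-invariant (HasLine alice) rotate-line b)
          (hasLine? alice (rotate b)) (hasLine? alice b))
  (does-⇔ (rotate-invariant (λ b → HasLine bob b ⊎ Full b) line-or-full b)
          (hasLine? bob (rotate b) ⊎-dec full? (rotate b)) (hasLine? bob b ⊎-dec full? b))
  where
  line-or-full : ∀ b → HasLine bob b ⊎ Full b → HasLine bob (rotate b) ⊎ Full (rotate b)
  line-or-full b (inj₁ l)  = inj₁ (rotate-line b l)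
  line-or-full b (inj₂ fl) = inj₂ (rotate-full b fl)

children-rotate : ∀ p b {c} → c ∈ children p b → rotate c ∈ children p (rotate b)
children-rotate p b c∈ with children⁻ p b c∈
... | s , s-empty , refl with rotate-update b s p s-empty
... | t , t-empty , eq =
        subst (_∈ children p (rotate b)) (sym eq) (children⁺ p (rotate b) t t-empty)

children-unrotate : ∀ p b {c} → c ∈ children p (rotate b) → ∃[ d ] d ∈ children p b × c ≡ rotate d
children-unrotate p b {c} c∈ =
    rotate (rotate (rotate c))
  , subst (λ b → _ ∈ children p b) (rotate⁴ b)
      (children-rotate p b₃ (children-rotate p b₂ (children-rotate p b₁ c∈)))
  , sym (rotate⁴ c)
  where
  b₁ = rotate b
  b₂ = rotate b₁
  b₃ = rotate b₂

-- Quarter turns already act transitively on the corners and on the edges, which leaves three first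
-- moves to compare.
value-rotate : ∀ k n b → value k n (rotate b) ≡ value k n b
value-rotate k zero    b = refl
value-rotate k (suc n) b = cong₂ (λ w v → outcome w (lost k) v) (winner-rotate b)
  (cong₂ (λ x y → mid (x ⊓ y) (x ⊔ y))
    (≤-antisym
      (≤bestMove As (bestMove≤lost As′) λ {c} c∈ →
        ≤-trans (bestMove≤ As′ (children-rotate alice b c∈)) (≤-reflexive (value-rotate k n c)))
      (≤bestMove As′ (bestMove≤lost As) λ c∈ →
        let (d , d∈ , c≡) = children-unrotate alice b c∈ in
        ≤-trans (bestMove≤ As d∈) (≤-reflexive (sym (rotated c≡)))))
    (≤-antisym
      (worstMove≤ Bs′ λ c∈ →
        let (d , d∈ , c≡) = children-unrotate bob b c∈ in
        ≤-trans (≤-reflexive (rotated c≡)) (≤worstMove Bs d∈))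
      (worstMove≤ Bs λ {c} c∈ →
        ≤-trans (≤-reflexive (sym (value-rotate k n c)))
                (≤worstMove Bs′ (children-rotate bob b c∈)))))
  where
  As  = children alice b
  As′ = children alice (rotate b)
  Bs  = children bob b
  Bs′ = children bob (rotate b)

  rotated : ∀ {c d} → c ≡ rotate d → value k n c ≡ value k n d
  rotated {d = d} c≡ = trans (cong (value k n) c≡) (value-rotate k n d)

-- Bounds from fixed strategies

-- Measured from each player's own side, a lower bound for the value is an upper bound for Bob's
-- cost, so one kind of bound serves both players.
cost : Player → ℕ → ℕ → Board → ℕ
cost alice k n b = value k n b
cost bob   k n b = lost k ∸ value k n b

-- The ceiling loses nothing and the floor at most one half, which cannot lower the integer `n`.
half-sum : ∀ {n} x y → n + n ≤ x + y → n ≤ ⌈ x /2⌉ + ⌊ y /2⌋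
half-sum {n} x y le = begin
  n                      ≡⟨ n≡⌊n+n/2⌋ n ⟩
  ⌊ n + n /2⌋            ≤⟨ ⌊/2⌋≤ (≤-trans le (≤-trans (+-mono-≤ (≤⌈/2⌉+⌈/2⌉ x) (≤1+⌊/2⌋+⌊/2⌋ y))
                              (≤-reflexive (eq ⌈ x /2⌉ ⌊ y /2⌋)))) ⟩
  ⌈ x /2⌉ + ⌊ y /2⌋      ∎
  where
  open ≤-Reasoning
  eq : ∀ u v → u + u + suc (v + v) ≡ suc ((u + v) + (u + v))
  eq = solve-∀

-- Up to exchanging the players, the complements of the values to the total
-- 2k + 2 satisfy the same recursion.
mid-complement : ∀ {k x y v w} → lost k ≤ x + w → lost k ≤ y + v → lost k ≤ mid x y + mid v w
mid-complement {k} {x} {y} {v} {w} x+w y+v = begin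
  suc k + suc k
    ≤⟨ +-mono-≤ (half-sum {suc k} x w x+w)
                (half-sum {suc k} v y (≤-trans y+v (≤-reflexive (+-comm y v)))) ⟩
  (⌈ x /2⌉ + ⌊ w /2⌋) + (⌈ v /2⌉ + ⌊ y /2⌋)
    ≡⟨ eq ⌈ x /2⌉ ⌊ w /2⌋ ⌈ v /2⌉ ⌊ y /2⌋ ⟩
  mid x y + mid v w
    ∎
  where
  open ≤-Reasoning
  eq : ∀ a b c d → (a + b) + (c + d) ≡ (a + d) + (c + b)
  eq = solve-∀

value-ongoing : ∀ k n b → winner b ≡ nothing →
  let x = bestMove k (value k n) (children alice b)
      y = worstMove (value k n) (children bob b)
  in value k (suc n) b ≡ mid (x ⊓ y) (x ⊔ y)
value-ongoing k n b none = cong (λ w → outcome w (lost k) (mid (x ⊓ y) (x ⊔ y))) none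
  where
  x = bestMove k (value k n) (children alice b)
  y = worstMove (value k n) (children bob b)

∸-swap : ∀ l {m n} → l ∸ m ≤ n → l ∸ n ≤ m
∸-swap l {m} {n} le = m≤n+o⇒m∸n≤o l n (≤-trans (m≤n+m∸n l m)
  (≤-trans (+-monoʳ-≤ m le) (≤-reflexive (+-comm m n))))

-- Committing `p` to the move `c` can only raise the cost. The bound `w` has to cover `c` as well,
-- since an opponent who wins the bid may make `p` move. For Bob the recursion is the complementary
-- one of `mid-complement`.
cost-step : ∀ p k n b {c w} → winner b ≡ nothing → c ∈ children p b → cost p k n c ≤ w →
            (∀ {d} → d ∈ children (opponent p) b → cost p k n d ≤ w) →
            cost p k (suc n) b ≤ mid (cost p k n c) w
cost-step alice k n b none c∈ c≤ d≤ = ≤-trans (≤-reflexive (value-ongoing k n b none))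
  (mid-mono (m≤n⇒m⊓o≤n _ x≤) (⊔-lub (≤-trans x≤ c≤) (worstMove≤ (children bob b) d≤)))
  where x≤ = bestMove≤ (children alice b) c∈
cost-step bob k n b {c} {w} none c∈ c≤ d≤ = m≤n+o⇒m∸n≤o (lost k) (value k (suc n) b)
  (subst (λ v → lost k ≤ v + mid (lost k ∸ value k n c) w) (sym (value-ongoing k n b none))
    (mid-complement {k} {x ⊓ y} {x ⊔ y} {lost k ∸ value k n c} {w} x⊓y+w x⊔y+v))
  where
  x = bestMove k (value k n) (children alice b)
  y = worstMove (value k n) (children bob b)

  v≤y : value k n c ≤ y
  v≤y = ≤worstMove (children bob b) c∈

  y+v : lost k ≤ y + (lost k ∸ value k n c)
  y+v = ≤-trans (m≤n+m∸n (lost k) (value k n c)) (+-monoˡ-≤ _ v≤y)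

  x⊔y+v : lost k ≤ (x ⊔ y) + (lost k ∸ value k n c)
  x⊔y+v = ≤-trans y+v (+-monoˡ-≤ _ (m≤n⊔m x y))

  lost∸w≤x⊓y : lost k ∸ w ≤ x ⊓ y
  lost∸w≤x⊓y = ⊓-glb
    (≤bestMove (children alice b) (m∸n≤m (lost k) w) (λ d∈ → ∸-swap (lost k) (d≤ d∈)))
    (≤-trans (∸-swap (lost k) c≤) v≤y)

  x⊓y+w : lost k ≤ (x ⊓ y) + w
  x⊓y+w = ≤-trans (m≤n+m∸n (lost k) w)
    (≤-trans (+-monoʳ-≤ w lost∸w≤x⊓y) (≤-reflexive (+-comm w (x ⊓ y))))

-- Bounds as functions of the total

-- From this total on, the affine bounds below separate the first moves.
K : ℕ
K = 124

-- An upper bound for a function of the total k: value by value for k < K, and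
-- (slope · (2k + 2) + offset) / 512 for every k. The denominator is 2⁹ since slopes
-- are halved at most nine times.
record Bound : Set where
  constructor bound
  field
    slope offset : ℕ
    values       : Vec ℕ K

record Covers (k n : ℕ) (B : Bound) : Set where
  constructor covers
  open Bound B
  field
    affine    : 512 * n ≤ slope * lost k + offset
    pointwise : ∀ i → toℕ i ≡ k → n ≤ lookup values i

zeroBound lostBound : Bound
zeroBound = bound 0 0 (replicate K 0)
lostBound = bound 512 0 (tabulate (lost ∘ toℕ))

-- Division on numerals is built in, whereas `⌊_/2⌋` recurses; this is the form that gets evaluated.
half : ℕ → ℕ
half n = n / 2

half≡ : ∀ n → half n ≡ ⌊ n /2⌋
half≡ zero          = refl
half≡ (suc zero)    = refl
half≡ (suc (suc n)) = trans (m/n≡1+[m∸n]/n {suc (suc n)} {2} (s≤s (s≤s z≤n))) (cong suc (half≡ n))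

fastMid : ℕ → ℕ → ℕ
fastMid x y = half (suc x) + half y

fastMid≡ : ∀ x y → fastMid x y ≡ mid x y
fastMid≡ x y = cong₂ _+_ (half≡ (suc x)) (half≡ y)

-- Rounding adds at most 1/2 = 256/512 in mid.
average join : Bound → Bound → Bound
average (bound s o v) (bound s′ o′ v′) =
  bound (half (suc (s + s′))) (half (suc (o + o′)) + 256) (zipWith fastMid v v′)
join (bound s o v) (bound s′ o′ v′) =
  bound (s ⊔′ s′) (o ⊔′ o′) (zipWith _⊔′_ v v′)

covers-weaken : ∀ {k m n B} → m ≤ n → Covers k n B → Covers k m B
covers-weaken m≤n (covers a p) =
  covers (≤-trans (*-monoʳ-≤ 512 m≤n) a) (λ i eq → ≤-trans m≤n (p i eq))

covers-zero : ∀ {k B} → Covers k 0 B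
covers-zero = covers z≤n (λ _ _ → z≤n)

covers-lost : ∀ {k n} → n ≤ lost k → Covers k n lostBound
covers-lost {k} {n} n≤ = covers
  (≤-trans (*-monoʳ-≤ 512 n≤) (≤-reflexive (sym (+-identityʳ (512 * lost k)))))
  λ { i refl → ≤-trans n≤ (≤-reflexive (sym (lookup∘tabulate (lost ∘ toℕ) i))) }

≤half+half : ∀ n → n ≤ half (suc n) + half (suc n)
≤half+half n = ≤-trans (≤⌈/2⌉+⌈/2⌉ n)
  (≤-reflexive (sym (cong₂ _+_ (half≡ (suc n)) (half≡ (suc n)))))

mid+mid≤ : ∀ x y → mid x y + mid x y ≤ suc (x + y)
mid+mid≤ x y = begin
  (⌈ x /2⌉ + ⌊ y /2⌋) + (⌈ x /2⌉ + ⌊ y /2⌋)  ≡⟨ eq ⌈ x /2⌉ ⌊ y /2⌋ ⟩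
  (⌈ x /2⌉ + ⌈ x /2⌉) + (⌊ y /2⌋ + ⌊ y /2⌋)
    ≤⟨ +-mono-≤ (up x) (≤-trans (+-monoʳ-≤ ⌊ y /2⌋ (⌊n/2⌋≤⌈n/2⌉ y)) (≤-reflexive (⌊n/2⌋+⌈n/2⌉≡n y))) ⟩
  suc x + y                                  ∎
  where
  open ≤-Reasoning
  eq : ∀ a b → (a + b) + (a + b) ≡ (a + a) + (b + b)
  eq = solve-∀
  up : ∀ x → ⌈ x /2⌉ + ⌈ x /2⌉ ≤ suc x
  up x = ≤-trans (+-monoʳ-≤ ⌈ x /2⌉ (⌊n/2⌋≤⌈n/2⌉ (suc x))) (≤-reflexive (⌊n/2⌋+⌈n/2⌉≡n (suc x)))

covers-average : ∀ {k m n} B C → Covers k m B → Covers k n C → Covers k (mid m n) (average B C)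
covers-average {k} {m} {n} (bound s o v) (bound s′ o′ v′) (covers a p) (covers a′ p′) = covers
  -- The inequality is proved doubled: twice `mid m n` exceeds `m + n` by at most one, and this
  -- `512` is split into the two summands `256`.
  (half-double-≤ (m≤n⇒m≤1+n (begin
    512 * mid m n + 512 * mid m n          ≡⟨ *-distribˡ-+ 512 (mid m n) (mid m n) ⟨
    512 * (mid m n + mid m n)              ≤⟨ *-monoʳ-≤ 512 (mid+mid≤ m n) ⟩
    512 * suc (m + n)                      ≡⟨ eq₁ 512 m n ⟩
    (512 * m + 512 * n) + 512              ≤⟨ +-monoˡ-≤ 512 (+-mono-≤ a a′) ⟩
    ((s * l + o) + (s′ * l + o′)) + 512    ≡⟨ eq₂ 512 s s′ o o′ l ⟩
    (s + s′) * l + (o + o′) + 512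
      ≤⟨ +-monoˡ-≤ 512 (+-mono-≤ (*-monoˡ-≤ l (≤half+half (s + s′))) (≤half+half (o + o′))) ⟩
    (S + S) * l + (O + O) + 512            ≡⟨ eq₃ 256 S O l ⟩
    (S * l + (O + 256)) + (S * l + (O + 256)) ∎)))
  λ i eq → begin
    mid m n                                ≤⟨ mid-mono (p i eq) (p′ i eq) ⟩
    mid (lookup v i) (lookup v′ i)         ≡⟨ fastMid≡ (lookup v i) (lookup v′ i) ⟨
    fastMid (lookup v i) (lookup v′ i)     ≡⟨ lookup-zipWith fastMid i v v′ ⟨
    lookup (zipWith fastMid v v′) i        ∎
  where
  open ≤-Reasoning
  l = lost k
  S = half (suc (s + s′))
  O = half (suc (o + o′))
  eq₁ : ∀ c m n → c * suc (m + n) ≡ (c * m + c * n) + c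
  eq₁ = solve-∀
  eq₂ : ∀ c s s′ o o′ l → ((s * l + o) + (s′ * l + o′)) + c ≡ (s + s′) * l + (o + o′) + c
  eq₂ = solve-∀
  eq₃ : ∀ c S O l → (S + S) * l + (O + O) + (c + c) ≡ (S * l + (O + c)) + (S * l + (O + c))
  eq₃ = solve-∀

covers-join : ∀ {k m n} B C → Covers k m B → Covers k n C → Covers k (m ⊔ n) (join B C)
covers-join {k} {m} {n} (bound s o v) (bound s′ o′ v′) (covers a p) (covers a′ p′) = covers
  (≤-trans (≤-reflexive (*-distribˡ-⊔ 512 m n)) (⊔-lub
    (≤-trans a (+-mono-≤ (*-monoˡ-≤ (lost k) (≤⊔′ s s′)) (≤⊔′ o o′)))
    (≤-trans a′ (+-mono-≤ (*-monoˡ-≤ (lost k) (≤⊔′ʳ s s′)) (≤⊔′ʳ o o′)))))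
  λ i eq → ≤-trans (⊔-mono-≤ (p i eq) (p′ i eq)) (≤-reflexive
    (trans (⊔≡⊔′ (lookup v i) (lookup v′ i)) (sym (lookup-zipWith _⊔′_ i v v′))))
  where
  ≤⊔′ : ∀ m n → m ≤ m ⊔′ n
  ≤⊔′ m n = ≤-trans (m≤m⊔n m n) (≤-reflexive (⊔≡⊔′ m n))
  ≤⊔′ʳ : ∀ m n → n ≤ m ⊔′ n
  ≤⊔′ʳ m n = ≤-trans (m≤n⊔m m n) (≤-reflexive (⊔≡⊔′ m n))

joinAll : ∀ {A : Set} → (A → Bound) → Bound → List A → Bound
joinAll B = foldr (λ d → join (B d))

-- The witness `w` is the maximum of `m` and all `g d`; it becomes the worst outcome of a lost bid
-- in `cost-step`.
covers-joinAll : ∀ {A : Set} {k m C} {g : A → ℕ} {B : A → Bound} → Covers k m C →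
  (∀ d → Covers k (g d) (B d)) → ∀ ds →
  ∃[ w ] m ≤ w × (∀ {d} → d ∈ ds → g d ≤ w) × Covers k w (joinAll B C ds)
covers-joinAll {m = m} cov covs [] = m , ≤-refl , (λ ()) , cov
covers-joinAll {g = g} cov covs (d ∷ ds) with covers-joinAll cov covs ds
... | w , m≤w , ds≤w , cov-w = g d ⊔ w , ≤-trans m≤w (m≤n⊔m (g d) w)
    , (λ { (here refl) → m≤m⊔n (g d) w ; (there d∈) → ≤-trans (ds≤w d∈) (m≤n⊔m (g d) w) })
    , covers-join _ _ (covs d) cov-w

-- Tabulated bounds for the Richman strategies

-- A table over all boards. By call-by-need its entries are evaluated at most once, and
-- not at all for the positions that the strategies in question never reach.
data Trie (A : Set) : ℕ → Set where
  leaf : A → Trie A 0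
  node : ∀ {n} (blank a b : Trie A n) → Trie A (suc n)

build : ∀ {A} n → (Cells n → A) → Trie A n
build zero    g = leaf (g [])
build (suc n) g = node (build n (g ∘ (nothing ∷_)))
                       (build n (g ∘ (just alice ∷_))) (build n (g ∘ (just bob ∷_)))

find : ∀ {A n} → Trie A n → Cells n → A
find (leaf x)     []               = x
find (node t _ _) (nothing ∷ b)    = find t b
find (node _ t _) (just alice ∷ b) = find t b
find (node _ _ t) (just bob ∷ b)   = find t b

find-build : ∀ {A} n (g : Cells n → A) b → find (build n g) b ≡ g b
find-build zero    g []               = refl
find-build (suc n) g (nothing ∷ b)    = find-build n _ b
find-build (suc n) g (just alice ∷ b) = find-build n _ b
find-build (suc n) g (just bob ∷ b)   = find-build n _ b

-- richman is 512 times Alice's Richman cost, her threshold share of the chips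
-- when bids are real numbers.
record Info : Set where
  constructor info
  field
    richman             : ℕ
    boundAlice boundBob : Bound
open Info

boundOf : Player → Info → Bound
boundOf alice = boundAlice
boundOf bob   = boundBob

-- Ties go to the first child; the bounds do not settle k = 5 if they go to the last.
cheapest : (Board → ℕ) → Board → List Board → Board
cheapest r c []       = c
cheapest r c (d ∷ ds) = if r d <ᵇ r c then cheapest r d ds else cheapest r c ds

cheapest∈ : ∀ r c ds → cheapest r c ds ∈ c ∷ ds
cheapest∈ r c []       = here refl
cheapest∈ r c (d ∷ ds) with r d <ᵇ r c
... | true  = there (cheapest∈ r d ds)
... | false with cheapest∈ r c ds
... | here eq  = here eq
... | there c∈ = there (there c∈)

-- The player's own move `C` also seeds the join, since an opponent who wins the bid may hand over
-- the move.
strategyBound : Player → (Board → ℕ) → (Board → Bound) → Board → List Board → Bound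
strategyBound p r B b []       = lostBound
strategyBound p r B b (c ∷ cs) = average C (joinAll B C (children (opponent p) b))
  where C = B (cheapest r c cs)

richmanStep : (Board → ℕ) → Board → ℕ
richmanStep r b = half (foldr (λ c → r c ⊓′_) 512 (children alice b) +
                        foldr (λ c → r c ⊔′_) 0 (children bob b))

infoStep : (Board → Info) → Board → Info
infoStep i b with winner b
... | just alice = info 0 zeroBound lostBound
... | just bob   = info 512 lostBound zeroBound
... | nothing    = info
        (richmanStep (richman ∘ i) b)
        (strategyBound alice (richman ∘ i) (boundAlice ∘ i) b (children alice b))
        -- Bob's Richman cost is the complementary share.
        (strategyBound bob (λ c → 512 ∸ richman (i c)) (boundBob ∘ i) b (children bob b))

nextTable : Trie Info 9 → Trie Info 9
nextTable t = build 9 (infoStep (find t))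

table : ℕ → Trie Info 9
table zero    = build 9 λ _ → info 512 lostBound lostBound
table (suc n) = nextTable (table n)

cost≤lost : ∀ p k n b → cost p k n b ≤ lost k
cost≤lost alice k n b = value≤lost k n b
cost≤lost bob   k n b = m∸n≤m (lost k) (value k n b)

-- Any estimate `r` yields a valid bound, because `cheapest` always selects a legal move; the
-- Richman costs only steer towards a sharp one.
covers-strategy : ∀ {k n p b r B} → winner b ≡ nothing →
  (∀ c → Covers k (cost p k n c) (B c)) → ∀ cs → (∀ {c} → c ∈ cs → c ∈ children p b) →
  Covers k (cost p k (suc n) b) (strategyBound p r B b cs)
covers-strategy {k} {n} {p} {b} none cov [] _ = covers-lost (cost≤lost p k (suc n) b)
covers-strategy {k} {n} {p} {b} {r} {B} none cov (c ∷ cs) cs⊆ =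
  let e = cheapest r c cs
      (w , e≤w , ds≤w , cov-w) =
        covers-joinAll {g = cost p k n} (cov e) cov (children (opponent p) b)
  in covers-weaken (cost-step p k n b none (cs⊆ (cheapest∈ r c cs)) e≤w ds≤w)
       (covers-average (B e) _ (cov e) cov-w)

covers-step : ∀ k n i → (∀ p b → Covers k (cost p k n b) (boundOf p (i b))) →
              ∀ p b → Covers k (cost p k (suc n) b) (boundOf p (infoStep i b))
covers-step k n i cov p b with winner b in none
covers-step k n i cov alice b | just alice = covers-zero′ none
  where
  covers-zero′ : winner b ≡ just alice → Covers k (cost alice k (suc n) b) zeroBound
  covers-zero′ eq rewrite eq = covers-zero
covers-step k n i cov bob b | just alice = covers-lost (cost≤lost bob k (suc n) b)
covers-step k n i cov alice b | just bob = covers-lost (cost≤lost alice k (suc n) b)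
covers-step k n i cov bob b | just bob = covers-zero′ none
  where
  covers-zero′ : winner b ≡ just bob → Covers k (cost bob k (suc n) b) zeroBound
  covers-zero′ eq rewrite eq | n∸n≡0 (lost k) = covers-zero
covers-step k n i cov alice b | nothing =
  covers-strategy {n = n} {alice} none (cov alice) (children alice b) id
covers-step k n i cov bob b | nothing =
  covers-strategy {n = n} {bob} none (cov bob) (children bob b) id

table-covers : ∀ k n p b → Covers k (cost p k n b) (boundOf p (find (table n) b))
table-covers k zero p b =
  subst (λ i → Covers k (cost p k 0 b) (boundOf p i))
    (sym (find-build 9 (λ _ → info 512 lostBound lostBound) b)) (start-covers p)
  where
  start-covers : ∀ p → Covers k (cost p k 0 b) (boundOf p (info 512 lostBound lostBound))
  start-covers alice = covers-lost (cost≤lost alice k 0 b)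
  start-covers bob   = covers-lost (cost≤lost bob k 0 b)
table-covers k (suc n) p b =
  subst (λ i → Covers k (cost p k (suc n) b) (boundOf p i))
    (sym (find-build 9 (infoStep (find (table n))) b))
    (covers-step k n (find (table n)) (table-covers k n) p b)

-- Restricted first moves

rankᶜ : ChipCount → ℕ
rankᶜ (plain a)   = rank bob a
rankᶜ (starred a) = rank alice a

≤ᶜ⇔rank : ∀ c d → c ≤ᶜ d ⇔ rankᶜ c ≤ rankᶜ d
≤ᶜ⇔rank c d = mk⇔ to′ (from′ c d)
  where
  to′ : ∀ {c d} → c ≤ᶜ d → rankᶜ c ≤ rankᶜ d
  to′ (plain≤plain le)     = +-mono-≤ le le
  to′ (plain≤starred le)   = m≤n⇒m≤1+n (+-mono-≤ le le)
  to′ (starred≤plain lt)   = +-mono-≤ lt (<⇒≤ lt)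
  to′ (starred≤starred le) = s≤s (+-mono-≤ le le)

  from′ : ∀ c d → rankᶜ c ≤ rankᶜ d → c ≤ᶜ d
  from′ (plain m)   (plain n)   le = plain≤plain (half-double-≤ (m≤n⇒m≤1+n le))
  from′ (plain m)   (starred n) le = plain≤starred (half-double-≤ le)
  from′ (starred m) (plain n)   le = starred≤plain
    (half-double-≤ (s≤s (≤-trans (≤-reflexive (+-suc m m)) le)))
  from′ (starred m) (starred n) le = starred≤starred (half-double-≤ (m≤n⇒m≤1+n (s≤s⁻¹ le)))

rankᶜ-injective : ∀ {c d} → rankᶜ c ≡ rankᶜ d → c ≡ d
rankᶜ-injective {c} {d} eq = antisym (from (≤ᶜ⇔rank c d) (≤-reflexive eq))
                                     (from (≤ᶜ⇔rank d c) (≤-reflexive (sym eq)))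
  where
  antisym : ∀ {c d} → c ≤ᶜ d → d ≤ᶜ c → c ≡ d
  antisym (plain≤plain m≤n)     (plain≤plain n≤m)     = cong plain (≤-antisym m≤n n≤m)
  antisym (plain≤starred m≤n)   (starred≤plain n<m)   = contradiction n<m (≤⇒≯ m≤n)
  antisym (starred≤plain m<n)   (plain≤starred n≤m)   = contradiction m<n (≤⇒≯ n≤m)
  antisym (starred≤starred m≤n) (starred≤starred n≤m) = cong starred (≤-antisym m≤n n≤m)

unrank : ∀ n → ∃[ c ] rankᶜ c ≡ n
unrank zero = plain 0 , refl
unrank (suc n) with unrank n
... | plain a , eq   = starred a , cong suc eq
... | starred a , eq = plain (suc a) , cong suc (trans (+-suc a a) eq)

amount≤ : ∀ {k} c → rankᶜ c < lost k → amount c ≤ k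
amount≤ {k} (plain a)   lt = half-double-≤ (≤-trans (s≤s⁻¹ lt) (≤-reflexive (+-suc k k)))
amount≤ {k} (starred a) lt = half-double-≤ (≤-trans (<⇒≤ (s≤s⁻¹ lt)) (≤-reflexive (+-suc k k)))

code-start : ∀ k c → code (start k c) ≡ rankᶜ c
code-start k (plain a)   = refl
code-start k (starred a) = refl

total-start : ∀ {k} c → amount c ≤ k → total (start k c) ≡ k
total-start (plain a)   = m+[n∸m]≡n
total-start (starred a) = m+[n∸m]≡n

-- If some `i < l` reaches `n`, compare at `i = n`; otherwise `n` equals the cap `l`, which is at
-- least `m`.
below-lost-unique : ∀ {l m n} → m ≤ l → n ≤ l → (∀ i → i < l → m ≤ i ⇔ n ≤ i) → m ≡ n
below-lost-unique {l} m≤l n≤l h = ≤-antisym (le m≤l n≤l λ i lt → from (h i lt))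
                                            (le n≤l m≤l λ i lt → to (h i lt))
  where
  le : ∀ {m n} → m ≤ l → n ≤ l → (∀ i → i < l → n ≤ i → m ≤ i) → m ≤ n
  le m≤l n≤l h with m≤n⇒m<n∨m≡n n≤l
  ... | inj₁ n<l  = h _ n<l ≤-refl
  ... | inj₂ refl = m≤l

rank-threshold : ∀ {T k m} → m ≤ lost k → Exact T k emptyBoard m → rankᶜ (threshold T k) ≡ m
rank-threshold {T} {k} {m} m≤ exact with threshold T k | threshold-correct T k
-- Since `lost k` is the rank of `plain (suc k)`, the cap in `IsThreshold` becomes the cap on ranks.
... | t | t≤ , correct = below-lost-unique (to (≤ᶜ⇔rank t _) t≤) m≤ agree
  where
  agree : ∀ i → i < lost k → rankᶜ t ≤ i ⇔ m ≤ i
  agree i i<l with unrank i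
  ... | c , refl = mk⇔
          (λ le → subst (m ≤_) (code-start k c)
                    (to wins (from (correct c c≤k) (from (≤ᶜ⇔rank t c) le))))
          (λ le → to (≤ᶜ⇔rank t c)
                    (to (correct c c≤k) (from wins (subst (m ≤_) (sym (code-start k c)) le))))
    where
    c≤k = amount≤ c i<l
    wins = exact (start k c) (total-start c c≤k)

Least : Subset 9 → (Square → ℕ) → ℕ → Set
Least T v x = (∃[ s ] s ∈ˢ T × v s ≡ x) × (∀ {s} → s ∈ˢ T → x ≤ v s)

abstract
  minimizer : ∀ {n} (v : Fin (suc n) → ℕ) → ∃[ m ] (∀ s → v m ≤ v s)
  minimizer {n} v =
    argmin v zero ss , λ s → All.lookup (f[argmin]≤f[xs] {f = v} zero ss) (∈-allFin s)
    where
    ss : List (Fin (suc n))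
    ss = allFin (suc n)

least-⊤ : ∀ v → ∃ (Least ⊤ v)
least-⊤ v with minimizer v
... | s , s≤ = v s , (s , ∈⊤ , refl) , λ {t} _ → s≤ t

afterFirst : Player → Square → Board
afterFirst p s = emptyBoard [ s ]≔ just p

-- The fuel `n` stays a variable, which keeps `value k n` from unfolding. Nine is enough because
-- eight blanks remain after the first move.
module _ (k : ℕ) {n : ℕ} (9≤n : 9 ≤ n) where

  firstValue : Square → ℕ
  firstValue s = value k n (afterFirst alice s)

  replyValue : ℕ
  replyValue = worstMove (value k n) (children bob emptyBoard)

  first-exact : ∀ {T} p s → Exact T k (afterFirst p s) (value k n (afterFirst p s))
  first-exact p s = value-exact n
    (≤-trans (blanks-update emptyBoard s p (lookup-replicate s nothing)) 9≤n)
    (update≢empty emptyBoard s p)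

  replyValue≤lost : replyValue ≤ lost k
  replyValue≤lost = worstMove≤ (children bob emptyBoard) (λ {c} _ → value≤lost k n c)

  rank-threshold-least : ∀ {T x} → Least T firstValue x →
                         rankᶜ (threshold T k) ≡ mid (x ⊓ replyValue) (x ⊔ replyValue)
  rank-threshold-least {T} {x} ((s₀ , s₀∈ , v≡x) , least) = rank-threshold
    (mid≤lost {k} (m≤n⇒m⊓o≤n _ x≤) (⊔-lub x≤ replyValue≤lost))
    (wins-step refl x≤ replyValue≤lost alice-moves
      (bob-moves {v = value k n} λ s _ → first-exact bob s))
    where
    x≤ : x ≤ lost k
    x≤ = subst (_≤ lost k) v≡x (value≤lost k n (afterFirst alice s₀))

    alice-moves : ∀ c → total c ≡ k → Move T emptyBoard alice c ⇔ x ≤ code c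
    alice-moves c eq = mk⇔
      (λ ((s , _ , s∈) , p) → ≤-trans (least (s∈ refl)) (to (first-exact alice s c eq) p))
      (λ le → (s₀ , lookup-replicate s₀ nothing , λ _ → s₀∈) ,
              from (first-exact alice s₀ c eq) (subst (_≤ code c) (sym v≡x) le))

  -- When `x ≤ replyValue`, the restricted and the unrestricted threshold both have the second
  -- summand `⌊ replyValue /2⌋`, which cancels.
  optimal⇔ : ∀ {T x} → Least T firstValue x → x ≤ replyValue →
             Optimal T k ⇔ (∀ s → ⌈ x /2⌉ ≤ ⌈ firstValue s /2⌉)
  optimal⇔ {T} {x} least@((s , _ , v≡x) , _) x≤y with least-⊤ firstValue
  ... | x₀ , least₀@((s₀ , _ , v≡x₀) , x₀≤) = mk⇔
        (λ opt s → ≤-trans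
          (≤-reflexive (+-cancelʳ-≡ ⌊ replyValue /2⌋ _ _
            (trans (sym (rank≡ least x≤y)) (trans (cong rankᶜ opt) rank₀≡))))
          (⌈n/2⌉-mono (x₀≤ ∈⊤)))
        (λ le → rankᶜ-injective (trans (rank≡ least x≤y) (trans
          (cong (_+ ⌊ replyValue /2⌋)
            (≤-antisym (subst (λ n → ⌈ x /2⌉ ≤ ⌈ n /2⌉) v≡x₀ (le s₀)) (⌈n/2⌉-mono x₀≤x)))
          (sym rank₀≡))))
    where
    x₀≤x : x₀ ≤ x
    x₀≤x = subst (x₀ ≤_) v≡x (x₀≤ ∈⊤)

    rank≡ : ∀ {T x} → Least T firstValue x → x ≤ replyValue →
            rankᶜ (threshold T k) ≡ mid x replyValue
    rank≡ least x≤y =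
      trans (rank-threshold-least least) (cong₂ mid (m≤n⇒m⊓n≡m x≤y) (m≤n⇒m⊔n≡n x≤y))

    rank₀≡ = rank≡ least₀ (≤-trans x₀≤x x≤y)

  v2≡ : firstValue (# 2) ≡ firstValue (# 0)
  v2≡ = value-rotate k n (afterFirst alice (# 0))
  v8≡ : firstValue (# 8) ≡ firstValue (# 0)
  v8≡ = trans (value-rotate k n (afterFirst alice (# 2))) v2≡
  v6≡ : firstValue (# 6) ≡ firstValue (# 0)
  v6≡ = trans (value-rotate k n (afterFirst alice (# 8))) v8≡
  v5≡ : firstValue (# 5) ≡ firstValue (# 1)
  v5≡ = value-rotate k n (afterFirst alice (# 1))
  v7≡ : firstValue (# 7) ≡ firstValue (# 1)
  v7≡ = trans (value-rotate k n (afterFirst alice (# 5))) v5≡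
  v3≡ : firstValue (# 3) ≡ firstValue (# 1)
  v3≡ = trans (value-rotate k n (afterFirst alice (# 7))) v7≡

  center-corner-or-edge : ∀ s → firstValue s ≡ firstValue (# 4) ⊎
                          firstValue s ≡ firstValue (# 0) ⊎ firstValue s ≡ firstValue (# 1)
  center-corner-or-edge zero = inj₂ (inj₁ refl)
  center-corner-or-edge (suc zero) = inj₂ (inj₂ refl)
  center-corner-or-edge (suc (suc zero)) = inj₂ (inj₁ v2≡)
  center-corner-or-edge (suc (suc (suc zero))) = inj₂ (inj₂ v3≡)
  center-corner-or-edge (suc (suc (suc (suc zero)))) = inj₁ refl
  center-corner-or-edge (suc (suc (suc (suc (suc zero))))) = inj₂ (inj₂ v5≡)
  center-corner-or-edge (suc (suc (suc (suc (suc (suc zero)))))) = inj₂ (inj₁ v6≡)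
  center-corner-or-edge (suc (suc (suc (suc (suc (suc (suc zero))))))) = inj₂ (inj₂ v7≡)
  center-corner-or-edge (suc (suc (suc (suc (suc (suc (suc (suc zero)))))))) = inj₂ (inj₁ v8≡)

  corner-value : ∀ {s} → s ∈ˢ corner → firstValue s ≡ firstValue (# 0)
  corner-value {zero} _ = refl
  corner-value {suc (suc zero)} _ = v2≡
  corner-value {suc (suc (suc (suc (suc (suc zero)))))} _ = v6≡
  corner-value {suc (suc (suc (suc (suc (suc (suc (suc zero)))))))} _ = v8≡
  corner-value {suc zero} (there ())
  corner-value {suc (suc (suc zero))} (there (there (there ())))
  corner-value {suc (suc (suc (suc zero)))} (there (there (there (there ()))))
  corner-value {suc (suc (suc (suc (suc zero))))} (there (there (there (there (there ())))))
  corner-value {suc (suc (suc (suc (suc (suc (suc zero))))))}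
    (there (there (there (there (there (there (there ())))))))

-- Comparison of center, corner and edge

cornerTotals : List ℕ
cornerTotals = 0 ∷ 1 ∷ 2 ∷ 3 ∷ 4 ∷ 5 ∷ 6 ∷ 7 ∷ 9 ∷ 11 ∷ 12 ∷ 13 ∷ 14 ∷ 19 ∷ 20 ∷ 22 ∷ 26 ∷ []

-- In terms of upper bounds (⁺) and lower bounds (⁻) for the values after Alice's
-- first move to the center (m), a corner (c), an edge (e), and after Bob's first
-- move to the center (b).
record Claims (k m⁺ m⁻ c⁺ c⁻ e⁻ b⁻ : ℕ) : Set where
  constructor claims
  field
    m≤c : k ≢ 5 → ⌈ m⁺ /2⌉ ≤ ⌈ c⁻ /2⌉
    m≤e : ⌈ m⁺ /2⌉ ≤ ⌈ e⁻ /2⌉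
    c<m : k ≡ 5 → ⌈ c⁺ /2⌉ < ⌈ m⁻ /2⌉
    m<c : ¬ k ∈ cornerTotals → ⌈ m⁺ /2⌉ < ⌈ c⁻ /2⌉
    c≤m : k ∈ cornerTotals → ⌈ c⁺ /2⌉ ≤ ⌈ m⁻ /2⌉
    c≤e : k ∈ cornerTotals → ⌈ c⁺ /2⌉ ≤ ⌈ e⁻ /2⌉
    m≤b : m⁺ ≤ b⁻
    c≤b : c⁺ ≤ b⁻

claims? : ∀ k m⁺ m⁻ c⁺ c⁻ e⁻ b⁻ → Dec (Claims k m⁺ m⁻ c⁺ c⁻ e⁻ b⁻)
claims? k m⁺ m⁻ c⁺ c⁻ e⁻ b⁻ = map′
  (λ (a , b , c , d , e , f , g , h) → claims a b c d e f g h)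
  (λ (claims a b c d e f g h) → a , b , c , d , e , f , g , h)
  (      (¬? (k ≟ 5) →-dec ⌈ m⁺ /2⌉ ≤? ⌈ c⁻ /2⌉)
   ×-dec (⌈ m⁺ /2⌉ ≤? ⌈ e⁻ /2⌉)
   ×-dec (k ≟ 5 →-dec ⌈ c⁺ /2⌉ <? ⌈ m⁻ /2⌉)
   ×-dec (¬? (k ∈? cornerTotals) →-dec ⌈ m⁺ /2⌉ <? ⌈ c⁻ /2⌉)
   ×-dec (k ∈? cornerTotals →-dec ⌈ c⁺ /2⌉ ≤? ⌈ m⁻ /2⌉)
   ×-dec (k ∈? cornerTotals →-dec ⌈ c⁺ /2⌉ ≤? ⌈ e⁻ /2⌉)
   ×-dec (m⁺ ≤? b⁻)
   ×-dec (c⁺ ≤? b⁻))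

-- Every claim has an upper bound on its smaller side and a lower bound on its larger side, so it
-- survives the passage to the exact values.
claims-weaken : ∀ {k m⁺ m⁻ c⁺ c⁻ e⁻ b⁻ m c e b} →
                m ≤ m⁺ → m⁻ ≤ m → c ≤ c⁺ → c⁻ ≤ c → e⁻ ≤ e → b⁻ ≤ b →
                Claims k m⁺ m⁻ c⁺ c⁻ e⁻ b⁻ → Claims k m m c c e b
claims-weaken m≤ ≤m c≤ ≤c ≤e ≤b (claims a b c d e f g h) = claims
  (λ p → ≤-trans (⌈n/2⌉-mono m≤) (≤-trans (a p) (⌈n/2⌉-mono ≤c)))
  (≤-trans (⌈n/2⌉-mono m≤) (≤-trans b (⌈n/2⌉-mono ≤e)))
  (λ p → ≤-<-trans (⌈n/2⌉-mono c≤) (<-≤-trans (c p) (⌈n/2⌉-mono ≤m)))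
  (λ p → ≤-<-trans (⌈n/2⌉-mono m≤) (<-≤-trans (d p) (⌈n/2⌉-mono ≤c)))
  (λ p → ≤-trans (⌈n/2⌉-mono c≤) (≤-trans (e p) (⌈n/2⌉-mono ≤m)))
  (λ p → ≤-trans (⌈n/2⌉-mono c≤) (≤-trans (f p) (⌈n/2⌉-mono ≤e)))
  (≤-trans m≤ (≤-trans g ≤b))
  (≤-trans c≤ (≤-trans h ≤b))

-- If B bounds v above and C bounds the complement of w above, the affine parts
-- leave w ≥ v + 2 for all k ≥ K.
Gap : Bound → Bound → Set
Gap (bound s o _) (bound s′ o′ _) = s + s′ ≤ 512 × o + o′ + 1024 ≤ (512 ∸ (s + s′)) * lost K

gap? : ∀ B C → Dec (Gap B C)
gap? (bound s o _) (bound s′ o′ _) =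
  s + s′ ≤? 512 ×-dec o + o′ + 1024 ≤? (512 ∸ (s + s′)) * lost K

-- Adding both affine bounds gives `512 * (w - v) ≥ (512 - s - s′) * lost k - (o +
-- o′)`, whose right side is smallest at `k = K`.
gap : ∀ {k v w} B C → K ≤ k → Gap B C → Covers k v B → Covers k (lost k ∸ w) C → 2 + v ≤ w
gap {k} {v} {w} (bound s o _) (bound s′ o′ _) K≤k (s≤ , o≤) (covers a _) (covers a′ _) =
  *-cancelˡ-≤ 512 (+-cancelʳ-≤ (512 * l) _ _ (begin
    512 * (2 + v) + 512 * l
      ≡⟨ eq₁ 512 v (512 * l) ⟩
    512 * v + 512 * l + 512 * 2
      ≤⟨ +-monoˡ-≤ (512 * 2) (+-mono-≤ a lost≤) ⟩
    s * l + o + (512 * w + (s′ * l + o′)) + 512 * 2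
      ≡⟨ eq₂ s s′ o o′ l (512 * w) (512 * 2) ⟩
    512 * w + ((s + s′) * l + (o + o′ + 512 * 2))
      ≤⟨ +-monoʳ-≤ (512 * w) (+-monoʳ-≤ ((s + s′) * l) o≤′) ⟩
    512 * w + ((s + s′) * l + (512 ∸ (s + s′)) * l)
      ≡⟨ cong (512 * w +_) (*-distribʳ-+ l (s + s′) (512 ∸ (s + s′))) ⟨
    512 * w + (s + s′ + (512 ∸ (s + s′))) * l
      ≡⟨ cong (λ n → 512 * w + n * l) (m+[n∸m]≡n s≤) ⟩
    512 * w + 512 * l
      ∎))
  where
  open ≤-Reasoning
  l = lost k
  lost≤ : 512 * l ≤ 512 * w + (s′ * l + o′)
  lost≤ = begin
    512 * l                        ≤⟨ *-monoʳ-≤ 512 (m≤n+m∸n l w) ⟩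
    512 * (w + (l ∸ w))            ≡⟨ *-distribˡ-+ 512 w (l ∸ w) ⟩
    512 * w + 512 * (l ∸ w)        ≤⟨ +-monoʳ-≤ (512 * w) a′ ⟩
    512 * w + (s′ * l + o′)        ∎
  o≤′ : o + o′ + 512 * 2 ≤ (512 ∸ (s + s′)) * l
  o≤′ = ≤-trans o≤ (*-monoʳ-≤ (512 ∸ (s + s′)) (+-mono-≤ (s≤s K≤k) (s≤s K≤k)))
  eq₁ : ∀ c v x → c * (2 + v) + x ≡ c * v + x + c * 2
  eq₁ = solve-∀
  eq₂ : ∀ s s′ o o′ l x y →
        s * l + o + (x + (s′ * l + o′)) + y ≡ x + ((s + s′) * l + (o + o′ + y))
  eq₂ = solve-∀

cornerTotals<K : ∀ {k} → k ∈ cornerTotals → k < K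
cornerTotals<K = All.lookup (from-yes (All.all? (_<? K) cornerTotals))

FirstMoveClaims : ℕ → ℕ → Set
FirstMoveClaims k n =
  Claims k (v alice (# 4)) (v alice (# 4)) (v alice (# 0)) (v alice (# 0))
           (v alice (# 1)) (v bob (# 4))
  where
  v : Player → Square → ℕ
  v p s = value k n (afterFirst p s)

-- With the bounds as a parameter `i`, the reasoning is type checked without evaluating the table.
module Checked (i : Player → Board → Bound) where

  M⁺ = i alice (afterFirst alice (# 4))
  M⁻ = i bob   (afterFirst alice (# 4))
  C⁺ = i alice (afterFirst alice (# 0))
  C⁻ = i bob   (afterFirst alice (# 0))
  E⁻ = i bob   (afterFirst alice (# 1))
  B⁻ = i bob   (afterFirst bob (# 4))

  at : Fin K → Bound → ℕ
  at j B = lookup (Bound.values B) j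

  SmallClaims : Fin K → Set
  SmallClaims j = Claims (toℕ j) (at j M⁺) (l ∸ at j M⁻) (at j C⁺) (l ∸ at j C⁻)
                         (l ∸ at j E⁻) (l ∸ at j B⁻)
    where l = lost (toℕ j)

  Check : Set
  Check = (∀ j → SmallClaims j) × Gap M⁺ C⁻ × Gap M⁺ E⁻ × Gap M⁺ B⁻ × Gap C⁺ B⁻

  check? : Dec Check
  check? = Fin.all? (λ j → claims? _ _ _ _ _ _ _) ×-dec
    gap? M⁺ C⁻ ×-dec gap? M⁺ E⁻ ×-dec gap? M⁺ B⁻ ×-dec gap? C⁺ B⁻

  module _ {n} (cov : ∀ k p b → Covers k (cost p k n b) (i p b)) (check : Check) (k : ℕ) where

    large : K ≤ k → FirstMoveClaims k n
    large K≤k = claims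
      (λ _ → <⇒≤ (ceil m<c))
      (<⇒≤ (ceil m<e))
      (λ { refl → contradiction K≤k (<⇒≱ (from-yes (5 <? K))) })
      (λ _ → ceil m<c)
      (λ k∈ → contradiction K≤k (<⇒≱ (cornerTotals<K k∈)))
      (λ k∈ → contradiction K≤k (<⇒≱ (cornerTotals<K k∈)))
      (m+n≤o⇒n≤o 2 (sep M⁺ B⁻ mb (cov k alice _) (cov k bob _)))
      (m+n≤o⇒n≤o 2 (sep C⁺ B⁻ cb (cov k alice _) (cov k bob _)))
      where
      sep : ∀ {v w} B C → Gap B C → Covers k v B → Covers k (lost k ∸ w) C → 2 + v ≤ w
      sep B C = gap B C K≤k
      -- A difference of two, unlike one of one, always stays strict after halving.
      ceil : ∀ {m n} → 2 + m ≤ n → ⌈ m /2⌉ < ⌈ n /2⌉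
      ceil = ⌈n/2⌉-mono
      mc = proj₁ (proj₂ check)
      me = proj₁ (proj₂ (proj₂ check))
      mb = proj₁ (proj₂ (proj₂ (proj₂ check)))
      cb = proj₂ (proj₂ (proj₂ (proj₂ check)))
      m<c = sep M⁺ C⁻ mc (cov k alice _) (cov k bob _)
      m<e = sep M⁺ E⁻ me (cov k alice _) (cov k bob _)

    all-claims : FirstMoveClaims k n
    all-claims with k <? K
    ... | no k≮K = large (≮⇒≥ k≮K)
    ... | yes k<K = claims-weaken (up alice) (low (up bob)) (up alice) (low (up bob))
                                  (low (up bob)) (low (up bob)) small
      where
      j : Fin K
      j = fromℕ< k<K
      j≡ : toℕ j ≡ k
      j≡ = Fin.toℕ-fromℕ< k<K
      up : ∀ p {b} → cost p k n b ≤ lookup (Bound.values (i p b)) j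
      up p {b} = Covers.pointwise (cov k p b) j j≡
      low : ∀ {w x} → lost k ∸ w ≤ x → lost k ∸ x ≤ w
      low = ∸-swap (lost k)
      small = subst (λ k → Claims k (at j M⁺) (lost k ∸ at j M⁻) (at j C⁺) (lost k ∸ at j C⁻)
                                    (lost k ∸ at j E⁻) (lost k ∸ at j B⁻)) j≡ (proj₁ check j)

module Conclusion (k : ℕ) {n : ℕ} (9≤n : 9 ≤ n)
  (first-moves : FirstMoveClaims k n) where

  open Claims first-moves

  v : Square → ℕ
  v = firstValue k 9≤n

  b≤reply : value k n (afterFirst bob (# 4)) ≤ replyValue k 9≤n
  b≤reply = ≤worstMove (children bob emptyBoard) (children⁺ bob emptyBoard (# 4) refl)

  everywhere : ∀ {x} → x ≤ ⌈ v (# 4) /2⌉ → x ≤ ⌈ v (# 0) /2⌉ → x ≤ ⌈ v (# 1) /2⌉ →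
               ∀ s → x ≤ ⌈ v s /2⌉
  everywhere {x} m c e s with center-corner-or-edge k 9≤n s
  ... | inj₁ eq        = subst (λ w → x ≤ ⌈ w /2⌉) (sym eq) m
  ... | inj₂ (inj₁ eq) = subst (λ w → x ≤ ⌈ w /2⌉) (sym eq) c
  ... | inj₂ (inj₂ eq) = subst (λ w → x ≤ ⌈ w /2⌉) (sym eq) e

  least-center : Least center v (v (# 4))
  least-center = (# 4 , x∈⁅x⁆ (# 4) , refl) , λ s∈ → ≤-reflexive (cong v (sym (x∈⁅y⁆⇒x≡y (# 4) s∈)))

  least-corner : Least corner v (v (# 0))
  least-corner = (# 0 , here , refl) , λ s∈ → ≤-reflexive (sym (corner-value k 9≤n s∈))

  center⇔ : Optimal center k ⇔ (k ≢ 5)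
  center⇔ = mk⇔
    (λ opt eq → <⇒≱ (c<m eq) (to opt⇔ opt (# 0)))
    (λ k≢5 → from opt⇔ (everywhere ≤-refl (m≤c k≢5) m≤e))
    where opt⇔ = optimal⇔ k 9≤n least-center (≤-trans m≤b b≤reply)

  corner⇔ : Optimal corner k ⇔ (k ∈ cornerTotals)
  corner⇔ = mk⇔ to′ (λ k∈ → from opt⇔ (everywhere (c≤m k∈) ≤-refl (c≤e k∈)))
    where
    opt⇔ = optimal⇔ k 9≤n least-corner (≤-trans c≤b b≤reply)
    to′ : Optimal corner k → k ∈ cornerTotals
    to′ opt with k ∈? cornerTotals
    ... | yes k∈ = k∈
    ... | no k∉  = contradiction (to opt⇔ opt (# 4)) (<⇒≱ (m<c k∉))

lookupBound : Trie Info 9 → Player → Board → Bound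
lookupBound t p b = boundOf p (find t b)

-- Settled by evaluation: all claims for `k < K` and the four affine gaps for the remaining totals.
check : Checked.Check (lookupBound (table 9))
check = toWitness {a? = Checked.check? (lookupBound (table 9))} _

theorem6p7 : (k : ℕ) →
    (Optimal center k ⇔ (k ≢ 5))
    × (Optimal corner k ⇔ (k ∈ (0 ∷ 1 ∷ 2 ∷ 3 ∷ 4 ∷ 5 ∷ 6 ∷ 7 ∷ 9 ∷ 11 ∷ 12 ∷ 13 ∷ 14 ∷ 19 ∷ 20 ∷ 22 ∷ 26 ∷ [])))
theorem6p7 k = center⇔ , corner⇔
  where
  open Conclusion k {9} ≤-refl
    (Checked.all-claims (lookupBound (table 9)) (λ k → table-covers k 9) check k)
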